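{- Let $\mathcal{M}$ be a deterministic Turing machine with a single binary tape that runs in time $t$. Then Hooper's small universal Turing machine $\mathcal{U}$ with $1$ state, $2$ symbols, and $4$ tapes simulates the computation of $\mathcal{M}$ in time $O(t^3)$.
   Context: **Binary Turing machine.** A (deterministic, single-tape) binary Turing machine is a tuple $M=(Q,\{0,1\},f,q_0,q_{|Q|-1})$, where $Q$ is a finite set of states, $\{0,1\}$ is the tape alphabet, $0$ is the blank symbol, $q_0\in Q$ is the start state and $q_{|Q|-1}\in Q$ is the halt state. The transition function $f: Q\times\{0,1\}\to\{0,1\}\times\{L,R\}\times Q$ is undefined exactly on $\{q_{|Q|-1}\}\times\{0,1\}$. A rule $(q_i,x_1,x_2,D,q_j)$ means: in state $q_i$ reading $x_1$, write $x_2$, move the head one cell in direction $D$, and enter state $q_j$. The tape is bi-infinite and all but finitely many cells contain $0$. **Wang B machine.** A Wang B machine has a single bi-infinite tape over $\{0,1\}$ (blank symbol $0$, finitely many $1$s), one head, and a finite list of instructions $\mathcal{W}=I_0,I_1,\ldots,I_{n-1}$, each of one of the forms: $L$ (move the head one cell left); $R$ (move the head one cell right); $M$ (mark: write $1$ in the current cell); $J(x)$ with $0\le x\le n-1$ (if the current cell contains $1$ then jump to instruction $I_x$, otherwise go on to the next instruction). Execution starts at $I_0$ and one instruction is executed per time step. After executing an $L$, $R$ or $M$ instruction $I_k$, or a jump $I_k=J(x)$ while reading $0$, the machine goes to $I_{k+1}$ if $k<n-1$ and halts if $k=n-1$. **Hooper's machine $\mathcal{U}$** (P. K. Hooper, 1963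 and 1969) is a fixed Turing machine with $1$ state, $2$ symbols and $4$ tapes: a non-erasing work tape, a read-only unidirectional circular program tape, and two read-write counter tapes. When it simulates a Wang B machine, the work tape contains exactly the contents of the Wang B machine's tape and the program tape stores the encoded instruction list. The known property of $\mathcal{U}$ that characterises it for the present purpose is: $\mathcal{U}$ simulates in linear time (in the sense below, with $g(t)=t$) every Wang B machine $I_0,\ldots,I_{n-1}$ satisfying the three restrictions (1) if $I_k=J(x)$ then $I_{k+1}\in\{L,R\}$; (2) each jump instruction jumps to an instruction in $\{L,R\}$, i.e. $I_k=J(x)$ implies $I_x\in\{L,R\}$; (3) $M$ instructions are executed only on tape cells that contain $0$. **Configuration.** A configuration consists of the control state (or current instruction index), the tape contents and the head position(s). **Simulation.** $B$ simulates the computation of $A$ in time $O(g(t))$ if there are an encoding $\varepsilon$ of initial configurations of $A$ as initial configurations of $B$ and a partial decoding $\delta$ from configurations of $B$ to configurations of $A$, both computable by finite-state transducers acting on the tape contents with head positions marked (for $B=\mathcal{U}$, the contents and initial head positions of all tapes other than the work tape depend only on $A$, and $\varepsilon$ acts on the work tape), such that for every initial configuration $c_0$ of $A$ with successive configurations $c_0,c_1,c_2,\ldots$, the run of $B$ started on $\varepsilon(c_0)$ passes, at times $s_0<s_1<s_2<\cdots$, through configurations decoding under $\delta$ to $c_0,c_1,c_2,\ldots$ respectively; $B$ ends its computation if and only if $A$ halts; and if $A$ runs in time $t$ then $B$ ends its computation within $O(g(t))$ steps, with constant depending only on $A$. **Time convention.** If a machine runs in time $t$, it halts within $t$ steps and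 uses at most $t$ tape cells (input cells included). -}

module Defs where

open import Data.Bool using (Bool; true; false; if_then_else_)
open import Data.Fin using (Fin; zero; suc; fromℕ; inject₁)
open import Data.Fin.Patterns using (0F; 1F; 2F; 3F)
open import Data.Fin.Properties using (_≟_)
open import Data.Fin.Relation.Unary.Top using (view; ‵fromℕ; ‵inject₁)
open import Data.Fin.Subset using (Subset; _∈_)
open import Data.List using (List; []; _∷_; _++_; map; reverse; length; tabulate; fromMaybe)
import Data.List.Membership.Propositional as List
open import Data.Maybe using (Maybe; just; nothing; maybe′; _>>=_)
import Data.Maybe as Maybe
open import Data.Nat using (ℕ; zero; suc; _+_; _*_; _≤_; _<_)
open import Data.Product using (Σ-syntax; ∃-syntax; _×_; _,_; proj₁)
open import Data.Unit using (⊤; tt)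
open import Data.Vec using (Vec; lookup)
open import Function using (id)
open import Function.Bundles using (_⇔_)
open import Relation.Binary.PropositionalEquality using (_≡_)
open import Relation.Nullary using (does)

data Direction : Set where
  L R : Direction

-- The symbols 0 and 1 are false and true.  Both side lists are stored
-- nearest cell first, and every cell beyond them is blank (false).
record Tape : Set where
  constructor tape
  field
    left    : List Bool
    scanned : Bool
    right   : List Bool

open Tape public

write : Bool → Tape → Tape
write b (tape l _ r) = tape l b r

move : Direction → Tape → Tape
move L (tape []      b r) = tape [] false (b ∷ r)
move L (tape (a ∷ l) b r) = tape l a (b ∷ r)
move R (tape l b [])      = tape (b ∷ l) false []
move R (tape l b (a ∷ r)) = tape (b ∷ l) a r

-- Moving never discards a listed cell and lists every cell it visits, so
-- along a run this counts the cells listed initially (the input cells, the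
-- scanned one included) together with all cells visited so far.
cells : Tape → ℕ
cells (tape l _ r) = length l + suc (length r)

data Letter (Q : Set) : Set where
  cell : Bool → Letter Q
  head : Q → Bool → Letter Q

cons : Bool → List Bool → List Bool
cons false [] = []
cons b     bs = b ∷ bs

-- Removes the blanks at the far end.
trim : List Bool → List Bool
trim []       = []
trim (b ∷ bs) = cons b (trim bs)

-- The shortest segment containing the head and every 1.  Two tapes that
-- differ only in how many outer blanks they list have the same word.
tapeWord : {Q : Set} → Q → Tape → List (Letter Q)
tapeWord q (tape l b r) =
  map cell (reverse (trim l)) ++ head q b ∷ map cell (trim r)

module _ {C : Set} (step : C → Maybe C) where

  -- nothing if the computation ends in fewer than n steps
  run : ℕ → C → Maybe C
  run zero    c = just c
  run (suc n) c = step c >>= run n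

  EndsAt : C → ℕ → C → Set
  EndsAt c n d = run n c ≡ just d × step d ≡ nothing

  Ends : C → Set
  Ends c = ∃[ n ] ∃[ d ] EndsAt c n d

record Config (k : ℕ) : Set where
  constructor config
  field
    control : Fin k
    content : Tape

open Config public

record Machine : Set where
  field
    controls : ℕ
    start    : Fin controls
    step     : Config controls → Maybe (Config controls)

  initial : Tape → Config controls
  initial = config start

configWord : {k : ℕ} → Config k → List (Letter (Fin k))
configWord (config q t) = tapeWord q t

-- On input t₀, halts within t steps and uses at most t cells.
RunsInTime : (A : Machine) → Tape → ℕ → Set
RunsInTime A t₀ t =
  ∃[ n ] ∃[ d ] (EndsAt step (initial t₀) n d × n ≤ t × cells (content d) ≤ t)
  where open Machine A

record TuringMachine : Set where
  field
    m : ℕ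

  State = Fin (suc m)

  field
    f           : State → Bool → Maybe (Bool × Direction × State)
    f-undefined : ∀ q b → (f q b ≡ nothing) ⇔ (q ≡ fromℕ m)

  stepTM : Config (suc m) → Maybe (Config (suc m))
  stepTM (config q t) =
    Maybe.map (λ (b , d , q′) → config q′ (move d (write b t))) (f q (scanned t))

  machine : Machine
  machine = record { controls = suc m ; start = zero ; step = stepTM }

data Instruction (n : ℕ) : Set where
  go   : Direction → Instruction n
  mark : Instruction n
  jump : Fin n → Instruction n

lower : {n : ℕ} → Fin (suc n) → Maybe (Fin n)
lower i with view i
... | ‵fromℕ     = nothing
... | ‵inject₁ k = just k

record WangB : Set where
  field
    n-1 : ℕ

  n = suc n-1

  field
    program : Vec (Instruction n) n

  -- The control inject₁ k means that I_k is executed next; the control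
  -- fromℕ n means that the machine has halted.
  execute : Fin n → Instruction n → Tape → Config (suc n)
  execute k (go d)   t = config (suc k) (move d t)
  execute k mark     t = config (suc k) (write true t)
  execute k (jump x) t = config (if scanned t then inject₁ x else suc k) t

  stepW : Config (suc n) → Maybe (Config (suc n))
  stepW (config i t) = Maybe.map (λ k → execute k (lookup program k) t) (lower i)

  machine : Machine
  machine = record { controls = suc n ; start = zero ; step = stepW }

  record Restricted : Set where
    field
      after-jump : ∀ k x → lookup program k ≡ jump x →
        ∃[ k′ ] (inject₁ k′ ≡ suc k × ∃[ d ] lookup program k′ ≡ go d)
      jump-target : ∀ k x → lookup program k ≡ jump x →
        ∃[ d ] lookup program x ≡ go d
      mark-on-0 : ∀ t₀ s k t →
        run stepW s (Machine.initial machine t₀) ≡ just (config (inject₁ k) t) →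
        lookup program k ≡ mark → scanned t ≡ false

record Circular : Set where
  constructor circular
  field
    {size-1} : ℕ
    symbols  : Vec Bool (suc size-1)
    position : Fin (suc size-1)

advance : Circular → Circular
advance (circular v i) = circular v (maybe′ suc zero (lower i))

circularWord : Circular → List (Letter ⊤)
circularWord (circular v i) =
  tabulate λ j → if does (j ≟ i) then head tt (lookup v j) else cell (lookup v j)

-- On the three bi-infinite tapes the head may also stay where it is.
act : Bool × Maybe Direction → Tape → Tape
act (b , d) t = maybe′ move id d (write b t)

-- The program tape is never written and its head moves in one direction only.
record Action : Set where
  field
    work     : Bool × Maybe Direction
    advances : Bool
    counter₁ : Bool × Maybe Direction
    counter₂ : Bool × Maybe Direction

record HooperConfig : Set where
  constructor hooperConfig
  field
    work     : Tape
    program  : Circular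
    counter₁ : Tape
    counter₂ : Tape

-- There is a single state, so a transition depends only on the symbols read
-- on the work, program and counter tapes.  The machine ends its computation
-- when the transition is undefined.
record HooperMachine : Set where
  field
    transition : (w p c₁ c₂ : Bool) → Maybe Action
    nonErasing : ∀ p c₁ c₂ a → transition true p c₁ c₂ ≡ just a →
                 proj₁ (Action.work a) ≡ true

  apply : Action → HooperConfig → HooperConfig
  apply a (hooperConfig w p c₁ c₂) = hooperConfig
    (act (Action.work a) w)
    (if Action.advances a then advance p else p)
    (act (Action.counter₁ a) c₁)
    (act (Action.counter₂ a) c₂)

  step : HooperConfig → Maybe HooperConfig
  step c@(hooperConfig w (circular v i) c₁ c₂) =
    Maybe.map (λ a → apply a c)
      (transition (scanned w) (lookup v i) (scanned c₁) (scanned c₂))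

-- The words of the four tapes in succession, each letter tagged by its tape.
hooperWord : HooperConfig → List (Fin 4 × Letter ⊤)
hooperWord (hooperConfig w p c₁ c₂) =
  map (0F ,_) (tapeWord tt w) ++ map (1F ,_) (circularWord p) ++
  map (2F ,_) (tapeWord tt c₁) ++ map (3F ,_) (tapeWord tt c₂)

-- A transition (p , x , y , q) consumes x and emits y, where nothing stands
-- for the empty word.
record Transducer (X Y : Set) : Set where
  field
    states      : ℕ
    initial     : Fin states
    accepting   : Subset states
    transitions : List (Fin states × Maybe X × Maybe Y × Fin states)

  data Path : Fin states → List X → List Y → Fin states → Set where
    done : ∀ {q} → Path q [] [] q
    step : ∀ {p x y q u v r} → (p , x , y , q) List.∈ transitions →
           Path q u v r → Path p (fromMaybe x ++ u) (fromMaybe y ++ v) r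

  Transduces : List X → List Y → Set
  Transduces u v = ∃[ q ] (q ∈ accepting × Path initial u v q)

  -- The transducer computes a partial function.
  Functional : Set
  Functional = ∀ {u v v′} → Transduces u v → Transduces u v′ → v ≡ v′

module _ (U : HooperMachine) (A : Machine) where
  private
    module U = HooperMachine U
    module A = Machine A

  Encoding Decoding : Set
  Encoding = Transducer (Letter (Fin A.controls)) (Letter ⊤)
  Decoding = Transducer (Fin 4 × Letter ⊤) (Letter (Fin A.controls))

  Decodes : Decoding → HooperConfig → Config A.controls → Set
  Decodes δ u c = Transducer.Transduces δ (hooperWord u) (configWord c)

  record Tracks (δ : Decoding) (c₀ : Config A.controls) (u₀ : HooperConfig) : Set where
    field
      -- Only the times s i for which A has an i-th configuration matter.
      s            : ℕ → ℕ
      s-increasing : ∀ i → s i < s (suc i)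
      passes       : ∀ i c → run A.step i c₀ ≡ just c →
                     ∃[ u ] (run U.step (s i) u₀ ≡ just u × Decodes δ u c)
      ends         : Ends U.step u₀ ⇔ Ends A.step c₀

  record Simulates (g : ℕ → ℕ) : Set where
    field
      program           : Circular
      counter₁ counter₂ : Tape
      ε                 : Encoding
      δ                 : Decoding
      constant          : ℕ
      ε-functional      : Transducer.Functional ε
      δ-functional      : Transducer.Functional δ
      simulation        : ∀ t₀ → Σ[ w ∈ Tape ]
        let c₀ = A.initial t₀
            u₀ = hooperConfig w program counter₁ counter₂
        in  Transducer.Transduces ε (configWord c₀) (tapeWord tt w) ×
            Tracks δ c₀ u₀ ×
            (∀ t → RunsInTime A t₀ t →
              ∃[ k ] ∃[ u ] (EndsAt U.step u₀ k u × k ≤ constant * g t))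

-- The property characterising Hooper's universal machine.
SimulatesRestrictedWangB : HooperMachine → Set
SimulatesRestrictedWangB U =
  (W : WangB) → WangB.Restricted W → Simulates U (WangB.machine W) (λ t → t)

module Submission where

-- Unable to erase, the Wang B machine keeps the current configuration of M on its
-- tape as a queue of blocks: it copies the configuration block by block to the right
-- end of the written region and sets a flag in each block it has copied.  Rewriting
-- with a delay of one symbol while copying performs one step of M and lengthens the
-- configuration by two blanks, which the decoder trims.  A copied block travels a
-- distance O(t), a configuration has O(t) blocks and there are at most t steps,
-- whence O(t³).  Jumps happen only on 1, so symbols have one-hot codes, which a chain
-- of jumps falling through on 0 can read, and every block ends in a 1, on which a
-- jump is unconditional.  When a new pass begins, the head separates the used blocks
-- on its left from the configuration on its right, so that a transducer can decode it.

open import Defs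
open import Data.Bool using (Bool; true; false; _∧_; if_then_else_)
import Data.Bool.Properties as Bool
open import Data.Fin using (Fin; zero; suc; combine; remQuot; fromℕ; inject₁; toℕ)
open import Data.Fin.Patterns using (0F; 1F; 2F; 3F; 4F)
import Data.Fin.Properties as Fin
open import Data.Fin.Properties
  using (combine-injective; combine-surjective; remQuot-combine;
         toℕ-injective; toℕ-combine; toℕ-inject₁; toℕ-fromℕ)
open import Data.Fin.Relation.Unary.Top using (view; view-fromℕ; view-inject₁; ‵fromℕ; ‵inject₁)
open import Data.Fin.Subset using (⁅_⁆)
open import Data.Fin.Subset.Properties using (x∈⁅x⁆; x∈⁅y⁆⇒x≡y)
open import Data.List
  using (List; []; _∷_; [_]; _++_; _ʳ++_; allFin; cartesianProductWith; concatMap; fromMaybe;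
         length; map; replicate; reverse)
  renaming (lookup to lookupˡ)
open import Data.List.Membership.Propositional using (find; lose) renaming (_∈_ to _∈ˡ_)
open import Data.List.Membership.Propositional.Properties
  using (∈-++⁺ˡ; ∈-++⁺ʳ; ∈-++⁻; ∈-map⁺; ∈-map⁻; ∈-concatMap⁺; ∈-concatMap⁻; ∈-allFin; ∈-∃++;
         ∈-cartesianProductWith⁺; ∈-cartesianProductWith⁻)
open import Data.List.Properties
  using (++-assoc; ++-cancelʳ; ++-identityʳ; ++-ʳ++; ʳ++-defn; ʳ++-ʳ++; concatMap-++;
         length-++; length-map; length-replicate; length-reverse; map-++; map-injective;
         reverse-++; unfold-reverse; ∷-injective; ∷-injectiveˡ; ∷-injectiveʳ)
open import Data.List.Relation.Unary.Any using (here; there)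
open import Data.Maybe using (Maybe; just; nothing; maybe′; _>>=_)
open import Data.Nat using (ℕ; zero; suc; _+_; _*_; _^_; _≤_; _<_; z≤n; s≤s)
open import Data.Nat.Properties
  using (suc-injective; n<1+n; n≤1+n; m≤m+n; m≤n+m; m≤n⇒m<n∨m≡n; <⇒≤; <-≤-trans;
         ≤-refl; ≤-reflexive; ≤-trans; module ≤-Reasoning;
         +-assoc; +-comm; +-identityʳ; +-suc; +-mono-≤; +-monoˡ-≤; +-monoʳ-≤; +-monoʳ-<;
         *-assoc; *-comm; *-suc; *-mono-≤; *-monoˡ-≤; *-monoʳ-≤)
open import Data.Nat.Tactic.RingSolver using (solve-∀)
open import Data.Product using (Σ-syntax; ∃-syntax; _×_; _,_; proj₁; proj₂; uncurry)
open import Data.Sum using (inj₁; inj₂)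
open import Data.Unit using (⊤; tt)
open import Data.Vec using (tabulate; lookup)
open import Data.Vec.Properties using (lookup∘tabulate; lookup⇒[]=; []=⇒lookup)
open import Function using (id; _∘_)
open import Function.Bundles using (_⇔_; mk⇔; module Equivalence)
open import Relation.Binary.Definitions using (DecidableEquality)
open import Relation.Binary.PropositionalEquality hiding ([_])
open import Relation.Nullary using (yes; no; contradiction)

-- Composition of transducers

-- A left move forces the delay: when the scanned cell is read, the cell to its left must not have
-- been written yet. Blanks are added whether or not they are needed, so the length of a
-- configuration depends only on the initial length and the number of steps, and the cost of a pass
-- can be bounded without looking at the computation. The ban on marking a 1 concerns runs from all
-- tapes, not only from encodings, so it cannot be derived from the shape of the queue. It is
-- secured locally instead: every operation compiles to five instructions that test a cell before
-- they mark it. Decoding has to be functional on all words. Codewords of equal length and the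
-- position of the first head letter achieve this. The linear-time simulation by `U` is granted in
-- terms of `RunsInTime`, which also counts cells. The space bound follows from the time bound,
-- because an instruction visits at most one new cell.

∧-true : ∀ {a b} → a ∧ b ≡ true → a ≡ true × b ≡ true
∧-true {true} {true} refl = refl , refl

module Composition {X Y Z : Set} (_≟_ : DecidableEquality Y)
                   (S : Transducer X Y) (T : Transducer Y Z) where
  private
    module S = Transducer S
    module T = Transducer T

  State : Set
  State = Fin (S.states * T.states)

  Transitionˢ Transitionᵗ Transition : Set
  Transitionˢ = Fin S.states × Maybe X × Maybe Y × Fin S.states
  Transitionᵗ = Fin T.states × Maybe Y × Maybe Z × Fin T.states
  Transition  = State × Maybe X × Maybe Z × State

  -- The product stores no part of the intermediate word: a letter emitted by `S` is consumed by `T`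
  -- in the same transition, while a transition of `S` that emits nothing, or of `T` that consumes
  -- nothing, leaves the other component in place.
  onBoth : Transitionˢ → Transitionᵗ → List Transition
  onBoth (p , x , just a , q) (p′ , just b , z , q′) with a ≟ b
  ... | yes _ = (combine p p′ , x , z , combine q q′) ∷ []
  ... | no  _ = []
  onBoth _ _ = []

  onFirst : Transitionˢ → Fin T.states → List Transition
  onFirst (p , x , nothing , q) p′ = (combine p p′ , x , nothing , combine q p′) ∷ []
  onFirst _                     _  = []

  onSecond : Fin S.states → Transitionᵗ → List Transition
  onSecond p (p′ , nothing , z , q′) = (combine p p′ , nothing , z , combine p q′) ∷ []
  onSecond _ _                       = []

  pairs : {A B C : Set} → (A → B → List C) → List A → List B → List C
  pairs f as bs = concatMap (λ a → concatMap (f a) bs) as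

  ∈-pairs⁺ : {A B C : Set} (f : A → B → List C) {as : List A} {bs : List B} →
             ∀ {a b c} → a ∈ˡ as → b ∈ˡ bs → c ∈ˡ f a b → c ∈ˡ pairs f as bs
  ∈-pairs⁺ f a∈ b∈ c∈ = ∈-concatMap⁺ _ (lose a∈ (∈-concatMap⁺ _ (lose b∈ c∈)))

  ∈-pairs⁻ : {A B C : Set} (f : A → B → List C) (as : List A) (bs : List B) →
             ∀ {c} → c ∈ˡ pairs f as bs →
             ∃[ a ] ∃[ b ] (a ∈ˡ as × b ∈ˡ bs × c ∈ˡ f a b)
  ∈-pairs⁻ f as bs c∈ with find (∈-concatMap⁻ (λ a → concatMap (f a) bs) {as} c∈)
  ... | a , a∈ , c∈′ with find (∈-concatMap⁻ (f a) {bs} c∈′)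
  ... | b , b∈ , c∈″ = a , b , a∈ , b∈ , c∈″

  bothAccept : Fin S.states × Fin T.states → Bool
  bothAccept (r , r′) = lookup S.accepting r ∧ lookup T.accepting r′

  compose : Transducer X Z
  compose = record
    { states      = S.states * T.states
    ; initial     = combine S.initial T.initial
    ; accepting   = tabulate (bothAccept ∘ remQuot T.states)
    ; transitions = pairs onBoth S.transitions T.transitions ++
                    pairs onFirst S.transitions (allFin T.states) ++
                    pairs onSecond (allFin S.states) T.transitions
    }

  private
    module C = Transducer compose

  -- The origins of a product transition, freed from the list computations so that paths can be
  -- analysed by pattern matching.
  data Joint : State → Maybe X → Maybe Z → State → Set where
    both   : ∀ {p x a q p′ z q′} → (p , x , just a , q) ∈ˡ S.transitions →
             (p′ , just a , z , q′) ∈ˡ T.transitions →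
             Joint (combine p p′) x z (combine q q′)
    first  : ∀ {p x q} {p′ : Fin T.states} → (p , x , nothing , q) ∈ˡ S.transitions →
             Joint (combine p p′) x nothing (combine q p′)
    second : ∀ {p : Fin S.states} {p′ z q′} → (p′ , nothing , z , q′) ∈ˡ T.transitions →
             Joint (combine p p′) nothing z (combine p q′)

  joint⁺ : ∀ {i x z j} → Joint i x z j → (i , x , z , j) ∈ˡ C.transitions
  joint⁺ (both {p} {x} {a} {q} {p′} {z} {q′} s∈ t∈) =
    ∈-++⁺ˡ (∈-pairs⁺ onBoth s∈ t∈ self)
    where
    self : (combine p p′ , x , z , combine q q′) ∈ˡ
           onBoth (p , x , just a , q) (p′ , just a , z , q′)
    self with a ≟ a
    ... | yes _ = here refl
    ... | no a≢a = contradiction refl a≢a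
  joint⁺ (first s∈) = ∈-++⁺ʳ (pairs onBoth S.transitions T.transitions)
    (∈-++⁺ˡ (∈-pairs⁺ onFirst s∈ (∈-allFin _) (here refl)))
  joint⁺ (second t∈) = ∈-++⁺ʳ (pairs onBoth S.transitions T.transitions)
    (∈-++⁺ʳ (pairs onFirst S.transitions (allFin T.states))
      (∈-pairs⁺ onSecond (∈-allFin _) t∈ (here refl)))

  joint⁻ : ∀ {i x z j} → (i , x , z , j) ∈ˡ C.transitions → Joint i x z j
  joint⁻ m∈ with ∈-++⁻ (pairs onBoth S.transitions T.transitions) m∈
  joint⁻ m∈ | inj₁ b∈ with ∈-pairs⁻ onBoth S.transitions T.transitions b∈
  ... | (p , x , just a , q) , (p′ , just b , z , q′) , s∈ , t∈ , m∈′ with a ≟ b | m∈′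
  ... | yes refl | here refl = both s∈ t∈
  joint⁻ m∈ | inj₂ m∈′ with ∈-++⁻ (pairs onFirst S.transitions (allFin T.states)) m∈′
  joint⁻ m∈ | inj₂ m∈′ | inj₁ f∈ with ∈-pairs⁻ onFirst S.transitions (allFin T.states) f∈
  ... | (p , x , nothing , q) , p′ , s∈ , _ , here refl = first s∈
  joint⁻ m∈ | inj₂ m∈′ | inj₂ s∈ with ∈-pairs⁻ onSecond (allFin S.states) T.transitions s∈
  ... | p , (p′ , nothing , z , q′) , _ , t∈ , here refl = second t∈

  -- The end points enter through equations because `combine` is not a constructor; its injectivity
  -- recovers the components at each step.
  split-path : ∀ {i u w j} → C.Path i u w j → ∀ p p′ r r′ →
               i ≡ combine p p′ → j ≡ combine r r′ →
               ∃[ v ] (S.Path p u v r × T.Path p′ v w r′)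
  split-path C.done p p′ r r′ refl j≡ with combine-injective p p′ r r′ j≡
  ... | refl , refl = [] , S.done , T.done
  split-path (C.step m∈ π) p p′ r r′ i≡ j≡ = via (joint⁻ m∈) π i≡
    where
    via : ∀ {i x z j u w} → Joint i x z j → C.Path j u w _ → i ≡ combine p p′ →
         ∃[ v ] (S.Path p (fromMaybe x ++ u) v r × T.Path p′ v (fromMaybe z ++ w) r′)
    via (both {p₁} {x} {a} {q} {p₂} {z} {q′} s∈ t∈) π i≡
      with refl , refl ← combine-injective p₁ p₂ p p′ i≡
      with v , σ , τ ← split-path π q q′ r r′ refl j≡ = a ∷ v , S.step s∈ σ , T.step t∈ τ
    via (first {p₁} {x} {q} {p₂} s∈) π i≡
      with refl , refl ← combine-injective p₁ p₂ p p′ i≡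
      with v , σ , τ ← split-path π q p′ r r′ refl j≡ = v , S.step s∈ σ , τ
    via (second {p₁} {p₂} {z} {q′} t∈) π i≡
      with refl , refl ← combine-injective p₁ p₂ p p′ i≡
      with v , σ , τ ← split-path π p q′ r r′ refl j≡ = v , σ , T.step t∈ τ

  -- Silent transitions are scheduled first. When neither side has one, the equation of the
  -- intermediate words leaves two cases: both paths are finished, or both continue with the same
  -- letter.
  join-path : ∀ {p u v r p′ v′ w r′} → S.Path p u v r → T.Path p′ v′ w r′ → v ≡ v′ →
              C.Path (combine p p′) u w (combine r r′)
  join-path (S.step {y = nothing} s∈ σ) τ v≡ = C.step (joint⁺ (first s∈)) (join-path σ τ v≡)
  join-path σ (T.step {x = nothing} t∈ τ) v≡ = C.step (joint⁺ (second t∈)) (join-path σ τ v≡)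
  join-path S.done T.done _ = C.done
  join-path (S.step {y = just a} s∈ σ) (T.step {x = just a} t∈ τ) refl =
    C.step (joint⁺ (both s∈ t∈)) (join-path σ τ refl)

  private
    accepts : ∀ r r′ → lookup C.accepting (combine r r′) ≡ bothAccept (r , r′)
    accepts r r′ = trans (lookup∘tabulate (bothAccept ∘ remQuot T.states) (combine r r′))
                         (cong bothAccept (remQuot-combine r r′))

  compose⁺ : ∀ {u v w} → S.Transduces u v → T.Transduces v w → C.Transduces u w
  compose⁺ (r , r∈ , σ) (r′ , r′∈ , τ) =
    combine r r′ ,
    lookup⇒[]= _ C.accepting
      (trans (accepts r r′) (cong₂ _∧_ ([]=⇒lookup r∈) ([]=⇒lookup r′∈))) ,
    join-path σ τ refl

  compose⁻ : ∀ {u w} → C.Transduces u w → ∃[ v ] (S.Transduces u v × T.Transduces v w)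
  compose⁻ (i , i∈ , π)
    with r , r′ , refl ← combine-surjective {S.states} {T.states} i
    with v , σ , τ ← split-path π S.initial T.initial r r′ refl refl
    with eS , eT ← ∧-true (trans (sym (accepts r r′)) ([]=⇒lookup i∈)) =
    v , (r , lookup⇒[]= r S.accepting eS , σ) , (r′ , lookup⇒[]= r′ T.accepting eT , τ)

  compose-functional : S.Functional → T.Functional → C.Functional
  compose-functional fS fT c c′
    with v , s , t ← compose⁻ c | v′ , s′ , t′ ← compose⁻ c′
    with refl ← fS s s′ = fT t t′

-- Transducers with words on their transitions

module WordTransducers (X Y : Set) where

  WordEdge LetterEdge : ℕ → Set
  WordEdge   n = Fin n × List X × List Y × Fin n
  LetterEdge n = Fin n × Maybe X × Maybe Y × Fin n

  EdgeRelation : ℕ → Set₁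
  EdgeRelation n = Fin n → List X → List Y → Fin n → Set

  data WordPath {n} (E : EdgeRelation n) : EdgeRelation n where
    done : ∀ {q} → WordPath E q [] [] q
    step : ∀ {p xs ys q u v r} → E p xs ys q → WordPath E q u v r →
           WordPath E p (xs ++ u) (ys ++ v) r

  map-path : ∀ {n} {E E′ : EdgeRelation n} → (∀ {p xs ys q} → E p xs ys q → E′ p xs ys q) →
             ∀ {p u v r} → WordPath E p u v r → WordPath E′ p u v r
  map-path f done       = done
  map-path f (step e π) = step (f e) (map-path f π)

  -- The fresh state `zero` has one edge in and one edge out, so a path between old states that
  -- enters it traverses both halves. This makes subdivision reversible.
  data Subdivided {n} (E : EdgeRelation n) (p : Fin n) (xs : List X) (ys : List Y)
                  (xs′ : List X) (ys′ : List Y) (q : Fin n) : EdgeRelation (suc n) where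
    old    : ∀ {a us vs b} → E a us vs b → Subdivided E p xs ys xs′ ys′ q (suc a) us vs (suc b)
    first  : Subdivided E p xs ys xs′ ys′ q (suc p) xs ys zero
    second : Subdivided E p xs ys xs′ ys′ q zero xs′ ys′ (suc q)

  data WithEdge {n} (E : EdgeRelation n) (p : Fin n) (xs : List X) (ys : List Y) (q : Fin n) :
                EdgeRelation n where
    other : ∀ {a us vs b} → E a us vs b → WithEdge E p xs ys q a us vs b
    this  : WithEdge E p xs ys q p xs ys q

  module _ {n : ℕ} {E : EdgeRelation n} {p : Fin n} {xs : List X} {ys : List Y}
           {xs′ : List X} {ys′ : List Y} {q : Fin n} where
    private
      Whole : EdgeRelation n
      Whole = WithEdge E p (xs ++ xs′) (ys ++ ys′) q
      Split : EdgeRelation (suc n)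
      Split = Subdivided E p xs ys xs′ ys′ q

    subdivide : ∀ {a u v b} → WordPath Whole a u v b → WordPath Split (suc a) u v (suc b)
    subdivide done = done
    subdivide (step (other e) π) = step (old e) (subdivide π)
    subdivide (step {u = u} {v = v} this π) =
      subst₂ (λ u v → WordPath Split (suc p) u v _)
        (sym (++-assoc xs xs′ u)) (sym (++-assoc ys ys′ v))
        (step first (step second (subdivide π)))

    merge : ∀ {a u v b} → WordPath Split (suc a) u v (suc b) → WordPath Whole a u v b
    merge₀ : ∀ {u v b} → WordPath Split zero u v (suc b) →
             ∃[ u′ ] ∃[ v′ ] (u ≡ xs′ ++ u′ × v ≡ ys′ ++ v′ × WordPath Whole q u′ v′ b)
    merge done             = done
    merge (step (old e) π) = step (other e) (merge π)
    merge (step first π) with merge₀ π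
    ... | u′ , v′ , refl , refl , π′ =
      subst₂ (λ u v → WordPath Whole p u v _) (++-assoc xs xs′ u′) (++-assoc ys ys′ v′)
        (step this π′)
    merge₀ (step second π) = _ , _ , refl , refl , merge π

  data LettersOf {n} (ts : List (LetterEdge n)) : EdgeRelation n where
    letters : ∀ {p x y q} → (p , x , y , q) ∈ˡ ts → LettersOf ts p (fromMaybe x) (fromMaybe y) q

  -- A stage of the expansion: the letter transitions already live on the enlarged state set, while
  -- the remaining word edges join original states, placed among the new ones by `ι`.
  data Mixed {m n} (ι : Fin m → Fin n) (ts : List (LetterEdge n)) (es : List (WordEdge m)) :
             EdgeRelation n where
    letter : ∀ {p xs ys q} → LettersOf ts p xs ys q → Mixed ι ts es p xs ys q
    word   : ∀ {p xs ys q} → (p , xs , ys , q) ∈ˡ es → Mixed ι ts es (ι p) xs ys (ι q)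

  record Spelled {m} (E : EdgeRelation m) : Set where
    field
      {size}  : ℕ
      embed   : Fin m → Fin size
      edges   : List (LetterEdge size)
      spell   : ∀ {p u v r} → WordPath E p u v r →
                WordPath (LettersOf edges) (embed p) u v (embed r)
      unspell : ∀ {p u v r} → WordPath (LettersOf edges) (embed p) u v (embed r) →
                WordPath E p u v r

  open Spelled

  respell : ∀ {m n} {E : EdgeRelation m} {E′ : EdgeRelation n} (f : Fin m → Fin n) →
            (∀ {p u v r} → WordPath E p u v r → WordPath E′ (f p) u v (f r)) →
            (∀ {p u v r} → WordPath E′ (f p) u v (f r) → WordPath E p u v r) →
            Spelled E′ → Spelled E
  respell f to from s = record
    { embed   = embed s ∘ f
    ; edges   = edges s
    ; spell   = spell s ∘ to
    ; unspell = from ∘ unspell s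
    }

  raise : ∀ {n} → LetterEdge n → LetterEdge (suc n)
  raise (p , x , y , q) = suc p , x , y , suc q

  module _ {m : ℕ} where

    spellAll : ∀ {n} (ι : Fin m → Fin n) ts es → Spelled (Mixed ι ts es)
    -- Peels one letter off the edge, input before output, and leads it to a fresh state where the
    -- rest of the edge starts. An empty transition remains at the end.
    spellEdge : ∀ {n} (ι : Fin m → Fin n) ts es p xs ys q →
                Spelled (WithEdge (Mixed ι ts es) p xs ys q)
    spellSubdivided : ∀ {n} (ι : Fin m → Fin n) ts es p x y xs ys q →
      Spelled (WithEdge (Mixed (suc ∘ ι) ((suc p , x , y , zero) ∷ map raise ts) es)
                        zero xs ys (suc q)) →
      Spelled (WithEdge (Mixed ι ts es) p (fromMaybe x ++ xs) (fromMaybe y ++ ys) q)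

    spellAll ι ts [] = record
      { embed   = id
      ; edges   = ts
      ; spell   = map-path (λ { (letter t) → t ; (word ()) })
      ; unspell = map-path letter
      }
    spellAll ι ts ((p , xs , ys , q) ∷ es) =
      respell id
        (map-path λ { (letter t)        → other (letter t)
                    ; (word (here refl)) → this
                    ; (word (there e))   → other (word e) })
        (map-path λ { (other (letter t)) → letter t
                    ; (other (word e))   → word (there e)
                    ; this               → word (here refl) })
        (spellEdge ι ts es (ι p) xs ys (ι q))

    spellEdge ι ts es p [] [] q =
      respell id
        (map-path λ { (other (letter (letters t))) → letter (letters (there t))
                    ; (other (word e))             → word e
                    ; this                         → letter (letters (here refl)) })
        (map-path λ { (letter (letters (here refl))) → this
                    ; (letter (letters (there t)))   → other (letter (letters t))
                    ; (word e)                       → other (word e) })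
        (spellAll ι ((p , nothing , nothing , q) ∷ ts) es)
    spellEdge ι ts es p (x ∷ xs) ys q =
      spellSubdivided ι ts es p (just x) nothing xs ys q
        (spellEdge (suc ∘ ι) ((suc p , just x , nothing , zero) ∷ map raise ts) es zero xs ys (suc q))
    spellEdge ι ts es p [] (y ∷ ys) q =
      spellSubdivided ι ts es p nothing (just y) [] ys q
        (spellEdge (suc ∘ ι) ((suc p , nothing , just y , zero) ∷ map raise ts) es zero [] ys (suc q))

    spellSubdivided ι ts es p x y xs ys q =
      respell suc (map-path to ∘ subdivide) (merge ∘ map-path from)
      where
      to : ∀ {a us vs b} →
        Subdivided (Mixed ι ts es) p (fromMaybe x) (fromMaybe y) xs ys q a us vs b →
        WithEdge (Mixed (suc ∘ ι) ((suc p , x , y , zero) ∷ map raise ts) es)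
          zero xs ys (suc q) a us vs b
      to (old (letter (letters t))) = other (letter (letters (there (∈-map⁺ raise t))))
      to (old (word e))             = other (word e)
      to first                      = other (letter (letters (here refl)))
      to second                     = this
      from : ∀ {a us vs b} →
        WithEdge (Mixed (suc ∘ ι) ((suc p , x , y , zero) ∷ map raise ts) es)
          zero xs ys (suc q) a us vs b →
        Subdivided (Mixed ι ts es) p (fromMaybe x) (fromMaybe y) xs ys q a us vs b
      from (other (letter (letters (here refl)))) = first
      from (other (letter (letters (there t)))) with ∈-map⁻ raise t
      ... | _ , t∈ , refl = old (letter (letters t∈))
      from (other (word e)) = old (word e)
      from this = second

  record WordTransducer : Set where
    field
      states  : ℕ
      initial : Fin states
      final   : Fin states
      wordEdges : List (WordEdge states)

    Edge : EdgeRelation states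
    Edge p xs ys q = (p , xs , ys , q) ∈ˡ wordEdges

    Accepts : List X → List Y → Set
    Accepts u v = WordPath Edge initial u v final

  module _ (W : WordTransducer) where
    private
      module W = WordTransducer W
      S : Spelled (Mixed id [] W.wordEdges)
      S = spellAll id [] W.wordEdges

    toTransducer : Transducer X Y
    toTransducer = record
      { states      = size S
      ; initial     = embed S W.initial
      ; accepting   = ⁅ embed S W.final ⁆
      ; transitions = edges S
      }

    private
      module T = Transducer toTransducer
      toPath : ∀ {p u v r} → WordPath (LettersOf (edges S)) p u v r → T.Path p u v r
      toPath done                 = T.done
      toPath (step (letters t) π) = T.step t (toPath π)
      fromPath : ∀ {p u v r} → T.Path p u v r → WordPath (LettersOf (edges S)) p u v r
      fromPath T.done       = done
      fromPath (T.step t π) = step (letters t) (fromPath π)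

    transduces⁺ : ∀ {u v} → W.Accepts u v → T.Transduces u v
    transduces⁺ π = _ , x∈⁅x⁆ _ , toPath (spell S (map-path word π))

    transduces⁻ : ∀ {u v} → T.Transduces u v → W.Accepts u v
    transduces⁻ (q , q∈ , π) with refl ← x∈⁅y⁆⇒x≡y _ q∈ =
      map-path (λ { (letter (letters ())) ; (word e) → e }) (unspell S (fromPath π))

-- Lifting a simulation along runs

letter-≟ : ∀ {n} → DecidableEquality (Letter (Fin n))
letter-≟ (cell a)   (cell b)   with a Bool.≟ b
... | yes refl = yes refl
... | no a≢b   = no λ { refl → a≢b refl }
letter-≟ (cell _)   (head _ _) = no λ ()
letter-≟ (head _ _) (cell _)   = no λ ()
letter-≟ (head p a) (head q b) with p Fin.≟ q | a Bool.≟ b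
... | yes refl | yes refl = yes refl
... | no p≢q   | _        = no λ { refl → p≢q refl }
... | yes refl | no a≢b   = no λ { refl → a≢b refl }

module _ {C : Set} {f : C → Maybe C} where

  run-+ : ∀ m n {c d} → run f m c ≡ just d → run f (m + n) c ≡ run f n d
  run-+ zero    n refl = refl
  run-+ (suc m) n {c} eq with f c
  ... | just c′ = run-+ m n eq

  EndsAt-+ : ∀ m {n c d e} → run f m c ≡ just d → EndsAt f d n e → EndsAt f c (m + n) e
  EndsAt-+ m {n} r (r′ , h) = trans (run-+ m n r) r′ , h

  -- The run is deterministic and has no step after its end, so a configuration met along the run
  -- lies at or before the end.
  EndsAt-cancel : ∀ m {n c d e} → run f m c ≡ just d → EndsAt f c n e →
                  ∃[ n′ ] (n ≡ m + n′ × EndsAt f d n′ e)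
  EndsAt-cancel zero refl ends = _ , refl , ends
  EndsAt-cancel (suc m) {zero}  {c} r (refl , h) with f c
  EndsAt-cancel (suc m) {zero}  {c} r (refl , ()) | just _
  EndsAt-cancel (suc m) {suc n} {c} r (r′ , h) with f c
  ... | just c′ with EndsAt-cancel m {n} r (r′ , h)
  ... | n′ , refl , ends = n′ , refl , ends

-- The index of `Inv` will be the length of the listed configuration: each step adds two blanks,
-- hence `2 + ℓ`, and the cost of a step depends on that length only.
module Lifting {C D : Set} (f : C → Maybe C) (g : D → Maybe D)
               (Inv : ℕ → C → D → Set) (cost : ℕ → ℕ)
               (cost-mono : ∀ {a b} → a ≤ b → cost a ≤ cost b)
               (advances : ∀ {ℓ c c′ d} → Inv ℓ c d → f c ≡ just c′ →
                 ∃[ k ] ∃[ d′ ] (run g (suc k) d ≡ just d′ × suc k ≤ cost ℓ × Inv (2 + ℓ) c′ d′))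
               (halts : ∀ {ℓ c d} → Inv ℓ c d → f c ≡ nothing →
                 ∃[ k ] ∃[ d′ ] (EndsAt g d k d′ × k ≤ cost ℓ)) where

  time : ∀ {ℓ c d} → Inv ℓ c d → ℕ → ℕ
  -- The value of `f c` is passed together with an equation, so that facts about `time` can be
  -- proved by cases on it.
  timeVia : ∀ {ℓ c d} → Inv ℓ c d → (m : Maybe C) → f c ≡ m → ℕ → ℕ
  time inv zero = zero
  time {c = c} inv (suc i) = timeVia inv (f c) refl i
  -- There is no further configuration to time; any strictly increasing continuation above 0 will
  -- do.
  timeVia inv nothing  _  i = suc i
  timeVia inv (just _) eq i =
    let k , _ , _ , _ , inv′ = advances inv eq in suc k + time inv′ i

  time-increasing : ∀ {ℓ c d} (inv : Inv ℓ c d) i → time inv i < time inv (suc i)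
  timeVia-increasing : ∀ {ℓ c d} (inv : Inv ℓ c d) m eq i →
                       timeVia inv m eq i < timeVia inv m eq (suc i)
  timeVia-positive : ∀ {ℓ c d} (inv : Inv ℓ c d) m eq → 0 < timeVia inv m eq 0
  time-increasing inv zero    = timeVia-positive inv _ refl
  time-increasing inv (suc i) = timeVia-increasing inv _ refl i
  timeVia-increasing inv nothing  eq i = n<1+n (suc i)
  timeVia-increasing inv (just _) eq i =
    let k , _ , _ , _ , inv′ = advances inv eq in +-monoʳ-< (suc k) (time-increasing inv′ i)
  timeVia-positive inv nothing  eq = s≤s z≤n
  timeVia-positive inv (just _) eq = s≤s z≤n

  reaches : ∀ {ℓ c d} (inv : Inv ℓ c d) i {c′} → run f i c ≡ just c′ →
            ∃[ d′ ] (run g (time inv i) d ≡ just d′ × ∃[ ℓ′ ] Inv ℓ′ c′ d′)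
  reachesVia : ∀ {ℓ c d} (inv : Inv ℓ c d) m eq i {c′} → (m >>= run f i) ≡ just c′ →
               ∃[ d′ ] (run g (timeVia inv m eq i) d ≡ just d′ × ∃[ ℓ′ ] Inv ℓ′ c′ d′)
  reaches inv zero refl = _ , refl , _ , inv
  reaches inv (suc i) r = reachesVia inv _ refl i r
  reachesVia inv (just _) eq i r =
    let k , _ , r₁ , _ , inv′ = advances inv eq
        d′ , r₂ , inv″ = reaches inv′ i r
    in d′ , trans (run-+ {f = g} (suc k) (time inv′ i) r₁) r₂ , inv″

  -- The `n` steps and the final attempt make `suc n` phases, none of which starts at a length above
  -- `2 * n + ℓ`.
  ends-within : ∀ {ℓ c d} → Inv ℓ c d → ∀ n {c′} → EndsAt f c n c′ →
                ∃[ k ] ∃[ d′ ] (EndsAt g d k d′ × k ≤ suc n * cost (2 * n + ℓ))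
  ends-within inv zero (refl , h) =
    let k , d′ , e , k≤ = halts inv h in k , d′ , e , ≤-trans k≤ (≤-reflexive (sym (+-identityʳ _)))
  ends-within {ℓ} {c} inv (suc n) (r , h) with f c in eq
  ... | just _ =
    let k , _ , r₁ , k≤ , inv′ = advances inv eq
        k′ , d′ , e , k′≤ = ends-within inv′ n (r , h)
    in suc k + k′ , d′ , EndsAt-+ {f = g} (suc k) {k′} r₁ e ,
       +-mono-≤ (≤-trans k≤ (cost-mono (m≤n+m ℓ (2 * suc n))))
         (≤-trans k′≤ (≤-reflexive (cong (λ a → suc n * cost a)
           (trans (sym (+-assoc (2 * n) 2 ℓ))
             (cong (_+ ℓ) (trans (+-comm (2 * n) 2) (sym (*-suc 2 n))))))))

  -- Induction on the bound `b` for the remaining steps of `g`: each step of `f` uses up at least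
  -- one of them.
  ends-reflected : ∀ {ℓ c d} → Inv ℓ c d → ∀ b {n e} → n < b → EndsAt g d n e → Ends f c
  ends-reflected {c = c} inv (suc b) {n} (s≤s n≤b) e with f c in eq
  ... | nothing = 0 , c , refl , eq
  ... | just c′ with advances inv eq
  ... | k , _ , r , _ , inv′ with EndsAt-cancel {f = g} (suc k) {n} r e
  ... | n′ , refl , e′ with ends-reflected inv′ b (≤-trans (s≤s (m≤n+m n′ k)) n≤b) e′
  ... | m , c″ , r′ , h = suc m , c″ , trans (cong (_>>= run f m) eq) r′ , h

  ends⇔ : ∀ {ℓ c d} → Inv ℓ c d → Ends g d ⇔ Ends f c
  ends⇔ inv = mk⇔
    (λ { (n , _ , e) → ends-reflected inv (suc n) ≤-refl e })
    (λ { (n , _ , e) → let k , d′ , e′ , _ = ends-within inv n e in k , d′ , e′ })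

-- The analogue of `Simulates` with `W` in the role of the universal machine. The last component
-- bounds the cells of `W` along with its time, as the linear-time simulation of `W` requires.
record Emulates (W A : Machine) (g : ℕ → ℕ) : Set where
  private
    module W = Machine W
    module A = Machine A
  field
    encoder  : Transducer (Letter (Fin A.controls)) (Letter (Fin W.controls))
    decoder  : Transducer (Letter (Fin W.controls)) (Letter (Fin A.controls))
    constant : ℕ
    encoder-functional : Transducer.Functional encoder
    decoder-functional : Transducer.Functional decoder
    emulation : ∀ t₀ → Σ[ t₁ ∈ Tape ]
      let c₀ = A.initial t₀
          d₀ = W.initial t₁
      in  Transducer.Transduces encoder (configWord c₀) (configWord d₀) ×
          (Σ[ r ∈ (ℕ → ℕ) ] ((∀ i → r i < r (suc i)) ×
            (∀ i c → run A.step i c₀ ≡ just c → ∃[ d ] (run W.step (r i) d₀ ≡ just d ×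
              Transducer.Transduces decoder (configWord d) (configWord c))))) ×
          (Ends W.step d₀ ⇔ Ends A.step c₀) ×
          (∀ t → RunsInTime A t₀ t → RunsInTime W t₁ (constant * g t))

strictly-increasing⇒≤ : (s : ℕ → ℕ) → (∀ i → s i < s (suc i)) → ∀ i j → i ≤ j → s i ≤ s j
strictly-increasing⇒≤ s inc i zero z≤n = ≤-refl
strictly-increasing⇒≤ s inc i (suc j) i≤ with m≤n⇒m<n∨m≡n i≤
... | inj₁ (s≤s i≤j) = ≤-trans (strictly-increasing⇒≤ s inc i j i≤j) (<⇒≤ (inc j))
... | inj₂ refl = ≤-refl

simulates-trans : ∀ {U W A g} → Simulates U W id → Emulates W A g → Simulates U A g
simulates-trans {U} {W} {A} {g} sim em = record
  { program      = S.program
  ; counter₁     = S.counter₁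
  ; counter₂     = S.counter₂
  ; ε            = Enc.compose
  ; δ            = Dec.compose
  ; constant     = S.constant * E.constant
  ; ε-functional = Enc.compose-functional E.encoder-functional S.ε-functional
  ; δ-functional = Dec.compose-functional S.δ-functional E.decoder-functional
  ; simulation   = simulation
  }
  where
  module S = Simulates sim
  module E = Emulates em
  module U = HooperMachine U
  module W = Machine W
  module A = Machine A
  module Enc = Composition letter-≟ E.encoder S.ε
  module Dec = Composition letter-≟ S.δ E.decoder

  simulation : ∀ t₀ → Σ[ w ∈ Tape ]
    let c₀ = A.initial t₀
        u₀ = hooperConfig w S.program S.counter₁ S.counter₂
    in  Transducer.Transduces Enc.compose (configWord c₀) (tapeWord _ w) ×
        Tracks U A Dec.compose c₀ u₀ ×
        (∀ t → RunsInTime A t₀ t →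
          ∃[ k ] ∃[ u ] (EndsAt U.step u₀ k u × k ≤ S.constant * E.constant * g t))
  simulation t₀ with E.emulation t₀
  ... | t₁ , enc , (r , r-inc , passes) , ends , timed with S.simulation t₁
  ... | w , enc′ , tracks , timed′ = w , Enc.compose⁺ enc enc′ , record
      { s            = T.s ∘ r
      ; s-increasing = λ i → <-≤-trans (T.s-increasing (r i))
                               (strictly-increasing⇒≤ T.s T.s-increasing _ _ (r-inc i))
      ; passes       = λ i c eq →
          let d , eq′ , dec = passes i c eq
              u , eq″ , dec′ = T.passes (r i) d eq′
          in u , eq″ , Dec.compose⁺ dec′ dec
      ; ends         = mk⇔ (Equivalence.to ends ∘ Equivalence.to T.ends)
                           (Equivalence.from T.ends ∘ Equivalence.from ends)
      } , λ t runs →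
        let k , u , e , k≤ = timed′ (E.constant * g t) (timed t runs)
        in k , u , e , ≤-trans k≤ (≤-reflexive (sym (*-assoc S.constant E.constant (g t))))
    where module T = Tracks tracks

-- Programs of move-and-branch operations

opposite : Direction → Direction
opposite L = R
opposite R = L

-- The plain inverse law fails on listed cells: stepping off the end and back lists one more blank.
-- After a first move in direction `d` the cell behind is listed, and the round trip restores the
-- tape literally.
move-opposite : ∀ d t → move d (move (opposite d) (move d t)) ≡ move d t
move-opposite L (tape [] b r)      = refl
move-opposite L (tape (a ∷ l) b r) = refl
move-opposite R (tape l b [])      = refl
move-opposite R (tape l b (a ∷ r)) = refl

scanned-opposite : ∀ d t → scanned (move d (move (opposite d) t)) ≡ scanned t
scanned-opposite L (tape l b [])      = refl
scanned-opposite L (tape l b (a ∷ r)) = refl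
scanned-opposite R (tape [] b r)      = refl
scanned-opposite R (tape (a ∷ l) b r) = refl

write-scanned : ∀ {b} t → scanned t ≡ b → write b t ≡ t
write-scanned t refl = refl

lower-inject₁ : ∀ {n} (i : Fin n) → lower (inject₁ i) ≡ just i
lower-inject₁ i rewrite view-inject₁ i = refl

lower-fromℕ : ∀ n → lower (fromℕ n) ≡ nothing
lower-fromℕ n rewrite view-fromℕ n = refl

data Target (Label : Set) : Set where
  next  : Target Label
  label : Label → Target Label
  halt  : Target Label

-- Move, then branch to the target when the cell reached contains 1;
-- otherwise mark that cell if required and go on to the following operation.
record Op (Label : Set) : Set where
  constructor op
  field
    direction : Direction
    target    : Target Label
    marks     : Bool

module _ {A : Set} where

  suffix : (xs : List A) → Fin (suc (length xs)) → List A
  suffix xs       zero    = xs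
  suffix (x ∷ xs) (suc k) = suffix xs k

  shift : ∀ ys {xs : List A} → Fin (suc (length xs)) → Fin (suc (length (ys ++ xs)))
  shift []       k = k
  shift (y ∷ ys) k = suc (shift ys k)

  suffix-shift : ∀ ys {xs : List A} k → suffix (ys ++ xs) (shift ys k) ≡ suffix xs k
  suffix-shift []       k = refl
  suffix-shift (y ∷ ys) k = suffix-shift ys k

  suffix-∷ : ∀ xs k {y ys} → suffix xs k ≡ y ∷ ys →
             ∃[ a ] (k ≡ inject₁ a × lookupˡ xs a ≡ y × suffix xs (suc a) ≡ ys)
  suffix-∷ (x ∷ xs) zero    refl = zero , refl , refl , refl
  suffix-∷ (x ∷ xs) (suc k) eq   =
    let a , k≡ , l≡ , s≡ = suffix-∷ xs k eq in suc a , cong suc k≡ , l≡ , s≡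

module Programs {Label : Set} (code : Label → List (Op Label))
                (labels : List Label) (complete : ∀ l → l ∈ˡ labels) where

  flat : List (Op Label)
  flat = concatMap code labels

  N : ℕ
  N = length flat

  startIn : ∀ {l ls} → l ∈ˡ ls → Fin (suc (length (concatMap code ls)))
  startIn (here _)               = zero
  startIn {ls = l ∷ _} (there p) = shift (code l) (startIn p)

  suffix-startIn : ∀ {l ls} (p : l ∈ˡ ls) →
                   ∃[ rest ] suffix (concatMap code ls) (startIn p) ≡ code l ++ rest
  suffix-startIn (here refl)            = _ , refl
  suffix-startIn {ls = l ∷ _} (there p) =
    let rest , eq = suffix-startIn p in rest , trans (suffix-shift (code l) (startIn p)) eq

  start : Label → Fin (suc N)
  start l = startIn (complete l)

  resolve : Fin N → Target Label → Fin (suc N)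
  resolve a next      = suc a
  resolve a (label l) = start l
  resolve a halt      = fromℕ N

  position : Fin (suc N) → Fin (suc (N * 5))
  position k = maybe′ (λ a → inject₁ (combine a 0F)) (fromℕ (N * 5)) (lower k)

  direction : Fin N → Direction
  direction a = Op.direction (lookupˡ flat a)

  marks : Fin N → Bool
  marks a = Op.marks (lookupˡ flat a)

  destination : Fin N → Fin (suc N)
  destination a = resolve a (Op.target (lookupˡ flat a))

  -- The instructions 2F and 3F lead away from the cell and back, so that the
  -- jump before them and the one after them are both followed by a move.
  instruction : Fin N → Fin 5 → Instruction (suc (N * 5))
  instruction a 0F = Instruction.go (direction a)
  instruction a 1F = jump (position (destination a))
  instruction a 2F = Instruction.go (opposite (direction a))
  instruction a 3F = Instruction.go (direction a)
  instruction a 4F = if marks a then mark else jump (position (destination a))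

  -- The extra last instruction is where jumps go in order to halt: the machine halts only by
  -- running past the end, which no jump can do. Being a move, it is an admissible jump target.
  instructionAt : Fin (suc (N * 5)) → Instruction (suc (N * 5))
  instructionAt k = maybe′ (uncurry instruction ∘ remQuot 5) (go R) (lower k)

  wangB : WangB
  wangB = record { n-1 = N * 5 ; program = tabulate instructionAt }

  open WangB wangB using (program; stepW; execute; Restricted)

  at : Fin N → Fin 5 → Fin (suc (N * 5))
  at a i = inject₁ (combine a i)

  lookup-at : ∀ a i → lookup program (at a i) ≡ instruction a i
  lookup-at a i rewrite lookup∘tabulate instructionAt (at a i)
                      | lower-inject₁ (combine a i) =
    cong (uncurry instruction) (remQuot-combine a i)

  lookup-end : lookup program (fromℕ (N * 5)) ≡ go R
  lookup-end rewrite lookup∘tabulate instructionAt (fromℕ (N * 5))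
                   | lower-fromℕ (N * 5) = refl

  position-inject₁ : ∀ a → position (inject₁ a) ≡ at a 0F
  position-inject₁ a rewrite lower-inject₁ a = refl

  position-fromℕ : position (fromℕ N) ≡ fromℕ (N * 5)
  position-fromℕ rewrite lower-fromℕ N = refl

  toℕ-position : ∀ k → toℕ (position k) ≡ 5 * toℕ k
  toℕ-position k with view k
  ... | ‵fromℕ     rewrite toℕ-fromℕ (N * 5) | toℕ-fromℕ N = *-comm N 5
  ... | ‵inject₁ a = begin
    toℕ (inject₁ (combine {N} {5} a 0F)) ≡⟨ toℕ-inject₁ (combine {N} {5} a 0F) ⟩
    toℕ (combine {N} {5} a 0F)           ≡⟨ toℕ-combine {N} {5} a 0F ⟩
    5 * toℕ a + 0                        ≡⟨ +-identityʳ (5 * toℕ a) ⟩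
    5 * toℕ a                            ≡⟨ cong (5 *_) (toℕ-inject₁ a) ⟨
    5 * toℕ (inject₁ a)                  ∎
    where open ≡-Reasoning

  position-zero : inject₁ (position zero) ≡ zero
  position-zero = toℕ-injective (trans (toℕ-inject₁ (position zero)) (toℕ-position zero))

  suc-at : ∀ a (i : Fin 4) → suc (at a (inject₁ i)) ≡ inject₁ (at a (suc i))
  suc-at a i = toℕ-injective (begin
    suc (toℕ (at a (inject₁ i)))           ≡⟨ cong suc (toℕ-inject₁ (combine a (inject₁ i))) ⟩
    suc (toℕ (combine a (inject₁ i)))      ≡⟨ cong suc (toℕ-combine a (inject₁ i)) ⟩
    suc (5 * toℕ a + toℕ (inject₁ i))      ≡⟨ cong (λ j → suc (5 * toℕ a + j)) (toℕ-inject₁ i) ⟩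
    suc (5 * toℕ a + toℕ i)                ≡⟨ +-suc (5 * toℕ a) (toℕ i) ⟨
    5 * toℕ a + suc (toℕ i)                ≡⟨ toℕ-combine a (suc i) ⟨
    toℕ (combine a (suc i))                ≡⟨ toℕ-inject₁ (combine a (suc i)) ⟨
    toℕ (at a (suc i))                     ≡⟨ toℕ-inject₁ (at a (suc i)) ⟨
    toℕ (inject₁ (at a (suc i)))           ∎)
    where open ≡-Reasoning

  suc-at-last : ∀ a → suc (at a 4F) ≡ inject₁ (position (suc a))
  suc-at-last a = toℕ-injective (begin
    suc (toℕ (at a 4F))              ≡⟨ cong suc (toℕ-inject₁ (combine a 4F)) ⟩
    suc (toℕ (combine a 4F))         ≡⟨ cong suc (toℕ-combine a 4F) ⟩
    suc (5 * toℕ a + 4)              ≡⟨ +-suc (5 * toℕ a) 4 ⟨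
    5 * toℕ a + 5                    ≡⟨ +-comm (5 * toℕ a) 5 ⟩
    5 + 5 * toℕ a                    ≡⟨ *-suc 5 (toℕ a) ⟨
    5 * suc (toℕ a)                  ≡⟨ toℕ-position (suc a) ⟨
    toℕ (position (suc a))           ≡⟨ toℕ-inject₁ (position (suc a)) ⟨
    toℕ (inject₁ (position (suc a))) ∎)
    where open ≡-Reasoning

  lookup-position : ∀ k → ∃[ d ] lookup program (position k) ≡ go d
  lookup-position k with view k
  ... | ‵fromℕ     = R , lookup-end
  ... | ‵inject₁ a = direction a , lookup-at a 0F

  step-at : ∀ a i t → stepW (config (inject₁ (at a i)) t) ≡
                      just (execute (at a i) (instruction a i) t)
  step-at a i t rewrite lower-inject₁ (at a i) | lookup-at a i = refl

  -- The restrictions on Wang B programs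

  data Place : Fin (suc (N * 5)) → Set where
    inside : ∀ a i → Place (at a i)
    end    : Place (fromℕ (N * 5))

  place : ∀ k → Place k
  place k with view k
  ... | ‵fromℕ     = end
  ... | ‵inject₁ j with a , i , refl ← combine-surjective {N} {5} j = inside a i

  -- An invariant of all runs, also of those on tapes that encode nothing: it
  -- guarantees that marks are made on 0 only.
  Known : Direction → Fin 5 → Tape → Set
  Known d 0F t = ⊤
  Known d 1F t = ⊤
  Known d 2F t = scanned t ≡ false
  Known d 3F t = scanned (move d t) ≡ false
  Known d 4F t = scanned t ≡ false

  index : Fin (suc (suc (N * 5))) → Maybe (Fin N × Fin 5)
  index c = lower c >>= λ k → lower k >>= λ j → just (remQuot 5 j)

  KnownAt : Maybe (Fin N × Fin 5) → Tape → Set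
  KnownAt (just (a , i)) t = Known (direction a) i t
  KnownAt nothing        t = ⊤

  index-at : ∀ a i → index (inject₁ (at a i)) ≡ just (a , i)
  index-at a i rewrite lower-inject₁ (at a i) | lower-inject₁ (combine a i) =
    cong just (remQuot-combine a i)

  Invariant : Config (suc (suc (N * 5))) → Set
  Invariant (config c t) = KnownAt (index c) t

  invariant-position : ∀ k t → Invariant (config (inject₁ (position k)) t)
  invariant-position k t with view k
  ... | ‵fromℕ rewrite lower-inject₁ (fromℕ (N * 5)) | lower-fromℕ (N * 5) = tt
  ... | ‵inject₁ a rewrite index-at a 0F = tt

  invariant-suc : ∀ a (i : Fin 4) {t} → Known (direction a) (suc i) t →
                  Invariant (config (suc (at a (inject₁ i))) t)
  invariant-suc a i {t} known = subst (λ c → Invariant (config c t)) (sym (suc-at a i))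
    (subst (λ k → KnownAt k t) (sym (index-at a (suc i))) known)

  invariant-last : ∀ a t → Invariant (config (suc (at a 4F)) t)
  invariant-last a t = subst (λ c → Invariant (config c t)) (sym (suc-at-last a))
    (invariant-position (suc a) t)

  -- The jump at `1F` falls through only on 0, and `2F` and `3F` lead back to the same cell. A jump
  -- taken leads to an offset `0F` or to the last instruction, where nothing has to be known.
  invariant-execute : ∀ a i t → Known (direction a) i t →
                      Invariant (execute (at a i) (instruction a i) t)
  invariant-execute a 0F t known = invariant-suc a 0F tt
  invariant-execute a 1F t known with scanned t in eq
  ... | true  = invariant-position (destination a) t
  ... | false = invariant-suc a 1F eq
  invariant-execute a 2F t known =
    invariant-suc a 2F (trans (scanned-opposite (direction a) t) known)
  invariant-execute a 3F t known = invariant-suc a 3F known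
  invariant-execute a 4F t known with marks a
  ... | true = invariant-last a (write true t)
  ... | false with scanned t
  ... | true  = invariant-position (destination a) t
  ... | false = invariant-last a t

  invariant-step : ∀ {c c′} → Invariant c → stepW c ≡ just c′ → Invariant c′
  invariant-step {config c t} inv eq with view c
  invariant-step {config _ t} inv refl | ‵inject₁ k with place k
  ... | inside a i rewrite lookup-at a i =
    invariant-execute a i t (subst (λ k → KnownAt k t) (index-at′ a i) inv)
    where
    index-at′ : ∀ a i → (lower (at a i) >>= λ j → just (remQuot {N} 5 j)) ≡ just (a , i)
    index-at′ a i rewrite lower-inject₁ (combine a i) = cong just (remQuot-combine a i)
  ... | end rewrite lookup-end | view-fromℕ (N * 5) = tt

  invariant-run : ∀ n {c c′} → Invariant c → run stepW n c ≡ just c′ → Invariant c′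
  invariant-run zero inv refl = inv
  invariant-run (suc n) {c} inv eq with stepW c in eq′
  ... | just c″ = invariant-run n (invariant-step {c} inv eq′) eq

  restricted : Restricted
  restricted = record
    { after-jump  = after-jump
    ; jump-target = jump-target
    ; mark-on-0   = mark-on-0
    }
    where
    after-jump : ∀ k x → lookup program k ≡ jump x →
                 ∃[ k′ ] (inject₁ k′ ≡ suc k × ∃[ d ] lookup program k′ ≡ go d)
    after-jump k x eq with place k
    after-jump _ x eq | end with () ← trans (sym lookup-end) eq
    after-jump _ x eq | inside a 0F with () ← trans (sym (lookup-at a 0F)) eq
    after-jump _ x eq | inside a 1F = at a 2F , sym (suc-at a 1F) , _ , lookup-at a 2F
    after-jump _ x eq | inside a 2F with () ← trans (sym (lookup-at a 2F)) eq
    after-jump _ x eq | inside a 3F with () ← trans (sym (lookup-at a 3F)) eq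
    after-jump _ x eq | inside a 4F =
      position (suc a) , sym (suc-at-last a) , lookup-position (suc a)

    target-position : ∀ a i {x} → instruction a i ≡ jump x → ∃[ k ] x ≡ position k
    target-position a 1F refl = destination a , refl
    target-position a 4F eq with marks a
    target-position a 4F refl | false = destination a , refl

    jump-target : ∀ k x → lookup program k ≡ jump x → ∃[ d ] lookup program x ≡ go d
    jump-target k x eq with place k
    jump-target _ x eq | end with () ← trans (sym lookup-end) eq
    jump-target _ x eq | inside a i
      with k , refl ← target-position a i (trans (sym (lookup-at a i)) eq) = lookup-position k

    mark-only : ∀ a i → instruction a i ≡ mark → i ≡ 4F
    mark-only a 4F _ = refl

    mark-on-0 : ∀ t₀ s k t →
      run stepW s (Machine.initial (WangB.machine wangB) t₀) ≡ just (config (inject₁ k) t) →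
      lookup program k ≡ mark → scanned t ≡ false
    mark-on-0 t₀ s k t r eq with place k
    mark-on-0 t₀ s _ t r eq | end with () ← trans (sym lookup-end) eq
    mark-on-0 t₀ s _ t r eq | inside a i
      with refl ← mark-only a i (trans (sym (lookup-at a i)) eq) =
      subst (λ k → KnownAt k t) (index-at a 4F) (invariant-run s initially r)
      where
      initially : Invariant (Machine.initial (WangB.machine wangB) t₀)
      initially = subst (λ c → Invariant (config c t₀)) position-zero (invariant-position zero t₀)

  -- Runs of operations, detached from addresses

  data Control : Set where
    entry  : Label → Control
    ops    : List (Op Label) → Control
    halted : Control

  operations : Control → List (Op Label)
  operations (entry l) = code l
  operations (ops os)  = os
  operations halted    = []

  Situation : Set
  Situation = Control × Tape

  follow : Target Label → List (Op Label) → Control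
  follow next      os = ops os
  follow (label l) os = entry l
  follow halt      os = halted

  perform : Op Label → List (Op Label) → Tape → Situation
  perform (op d x b) os t =
    if scanned (move d t) then (follow x os , move d t) else (ops os , write b (move d t))

  -- The index is an upper bound on the number of operations, so costs can be rounded up on the way.
  -- `Reach⁺` performs at least one operation, which later makes the simulation times strictly
  -- increasing.
  data Reach⁺ : ℕ → Situation → Situation → Set
  data Reach : ℕ → Situation → Situation → Set

  data Reach⁺ where
    perform-first : ∀ {n c t o os s} → operations c ≡ o ∷ os →
                    Reach n (perform o os t) s → Reach⁺ (suc n) (c , t) s

  data Reach where
    stay : ∀ {n s} → Reach n s s
    some : ∀ {n s s′} → Reach⁺ n s s′ → Reach n s s′

  weaken⁺ : ∀ {m n s s′} → m ≤ n → Reach⁺ m s s′ → Reach⁺ n s s′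
  weaken : ∀ {m n s s′} → m ≤ n → Reach m s s′ → Reach n s s′
  weaken⁺ (s≤s m≤n) (perform-first eq ρ) = perform-first eq (weaken m≤n ρ)
  weaken m≤n stay     = stay
  weaken m≤n (some ρ) = some (weaken⁺ m≤n ρ)

  infixr 5 _◅◅⁺_ _◅◅_

  _◅◅⁺_ : ∀ {m n s s′ s″} → Reach⁺ m s s′ → Reach n s′ s″ → Reach⁺ (m + n) s s″
  _◅◅_ : ∀ {m n s s′ s″} → Reach m s s′ → Reach n s′ s″ → Reach (m + n) s s″
  perform-first eq ρ ◅◅⁺ σ = perform-first eq (ρ ◅◅ σ)
  _◅◅_ {m} {n} stay σ = weaken (m≤n+m n m) σ
  some ρ ◅◅ σ         = some (ρ ◅◅⁺ σ)

  -- `ops os` only says what comes next, whereas `entry l` fixes the address: a run that returns to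
  -- a label returns to the same control, by which the decoder recognises the beginning of a pass.
  Located : Control → Fin (suc N) → Set
  Located (entry l) k = k ≡ start l
  Located (ops os)  k = ∃[ rest ] suffix flat k ≡ os ++ rest
  Located halted    k = k ≡ fromℕ N

  located-operations : ∀ c {k} → Located c k →
                       ∃[ rest ] suffix flat k ≡ operations c ++ rest
  located-operations (entry l) refl = suffix-startIn (complete l)
  located-operations (ops os)  loc  = loc
  located-operations halted    loc  = _ , refl

  located-follow : ∀ x os a {rest} → suffix flat (suc a) ≡ os ++ rest →
                   Located (follow x os) (resolve a x)
  located-follow next      os a eq = _ , eq
  located-follow (label l) os a eq = refl
  located-follow halt      os a eq = refl

  wconfig : Fin (suc N) → Tape → Config (suc (suc (N * 5)))
  wconfig k t = config (inject₁ (position k)) t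

  first-step : ∀ n {m : Maybe (Config (suc (suc (N * 5))))} {c d} →
               m ≡ just c → run stepW n c ≡ d → (m >>= run stepW n) ≡ d
  first-step n refl r = r

  step-go : ∀ a (i : Fin 4) d t → instruction a (inject₁ i) ≡ go d →
            stepW (config (inject₁ (at a (inject₁ i))) t) ≡
            just (config (inject₁ (at a (suc i))) (move d t))
  step-go a i d t eq =
    trans (step-at a (inject₁ i) t)
      (cong just (trans (cong (λ j → execute (at a (inject₁ i)) j t) eq)
        (cong (λ c → config c (move d t)) (suc-at a i))))

  fall-through : ∀ a t → let d = direction a in scanned (move d t) ≡ false →
                 run stepW 5 (config (inject₁ (at a 0F)) t) ≡
                 just (wconfig (suc a) (write (marks a) (move d t)))
  fall-through a t eq =
    first-step 4 (step-go a 0F d t refl)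
      (first-step 3 no-jump
        (first-step 2 (step-go a 2F (opposite d) (move d t) refl)
          (first-step 1 (step-go a 3F d (move (opposite d) (move d t)) refl)
            (first-step 0 last refl))))
    where
    d : Direction
    d = direction a
    no-jump : stepW (config (inject₁ (at a 1F)) (move d t)) ≡
              just (config (inject₁ (at a 2F)) (move d t))
    no-jump rewrite step-at a 1F (move d t) | eq | suc-at a 1F = refl
    last : stepW (config (inject₁ (at a 4F)) (move d (move (opposite d) (move d t)))) ≡
           just (wconfig (suc a) (write (marks a) (move d t)))
    last rewrite move-opposite d t | step-at a 4F (move d t) with marks a
    ... | true  = cong (λ c → just (config c (write true (move d t)))) (suc-at-last a)
    -- Without a mark the fifth instruction repeats the jump, which has no effect because the cell
    -- contains 0.
    ... | false rewrite eq = cong₂ (λ c t → just (config c t)) (suc-at-last a)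
                               (sym (write-scanned (move d t) eq))

  branch : ∀ a t → scanned (move (direction a) t) ≡ true →
           run stepW 2 (config (inject₁ (at a 0F)) t) ≡
           just (wconfig (destination a) (move (direction a) t))
  branch a t eq = first-step 1 (step-go a 0F d t refl) (first-step 0 jump-taken refl)
    where
    d : Direction
    d = direction a
    jump-taken : stepW (config (inject₁ (at a 1F)) (move d t)) ≡
                 just (wconfig (destination a) (move d t))
    jump-taken rewrite step-at a 1F (move d t) | eq = refl

  perform-run : ∀ c k t {o os} → Located c k → operations c ≡ o ∷ os →
    let c′ , t′ = perform o os t in
    ∃[ n ] ∃[ k′ ] (Located c′ k′ × run stepW (suc n) (wconfig k t) ≡ just (wconfig k′ t′) × suc n ≤ 5)
  perform-run c k t {o} {os} loc eq with located-operations c loc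
  ... | rest , s≡ with suffix-∷ flat k (trans s≡ (cong (_++ rest) eq))
  ... | a , refl , refl , s≡′ with scanned (move (direction a) t) in e
  ... | true  = 1 , destination a , located-follow (Op.target o) os a s≡′ ,
                trans (cong (λ p → run stepW 2 (config (inject₁ p) t)) (position-inject₁ a))
                  (branch a t e) ,
                s≤s (s≤s z≤n)
  ... | false = 4 , suc a , (rest , s≡′) ,
                trans (cong (λ p → run stepW 5 (config (inject₁ p) t)) (position-inject₁ a))
                  (fall-through a t e) ,
                ≤-refl

  reach⁺-run : ∀ {n c t c′ t′ k} → Reach⁺ n (c , t) (c′ , t′) → Located c k →
    ∃[ m ] ∃[ k′ ] (Located c′ k′ × run stepW (suc m) (wconfig k t) ≡ just (wconfig k′ t′) ×
                    suc m ≤ n * 5)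
  reach-run : ∀ {n c t c′ t′ k} → Reach n (c , t) (c′ , t′) → Located c k →
    ∃[ m ] ∃[ k′ ] (Located c′ k′ × run stepW m (wconfig k t) ≡ just (wconfig k′ t′) ×
                    m ≤ n * 5)
  reach⁺-run {c = c} {t} {k = k} (perform-first eq ρ) loc =
    let m , k′ , loc′ , r , m≤  = perform-run c k t loc eq
        n , k″ , loc″ , r′ , n≤ = reach-run ρ loc′
    in m + n , k″ , loc″ , trans (run-+ {f = stepW} (suc m) n {wconfig k t} {wconfig k′ _} r) r′ , +-mono-≤ m≤ n≤
  reach-run stay     loc = 0 , _ , loc , refl , z≤n
  reach-run (some ρ) loc =
    let m , k′ , loc′ , r , m≤ = reach⁺-run ρ loc in suc m , k′ , loc′ , r , m≤

  halted-ends : ∀ t → ∃[ c ] EndsAt stepW (wconfig (fromℕ N) t) 1 c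
  halted-ends t rewrite position-fromℕ =
    config (fromℕ (suc (N * 5))) (move R t) , first-step 0 last refl , over
    where
    last : stepW (config (inject₁ (fromℕ (N * 5))) t) ≡
           just (config (fromℕ (suc (N * 5))) (move R t))
    last rewrite lower-inject₁ (fromℕ (N * 5)) | lookup-end = refl
    over : stepW (config (fromℕ (suc (N * 5))) (move R t)) ≡ nothing
    over rewrite lower-fromℕ (suc (N * 5)) = refl

  cells-move : ∀ d t → cells (move d t) ≤ suc (cells t)
  cells-move L (tape []      b r) = ≤-refl
  cells-move L (tape (a ∷ l) b r) =
    ≤-trans (≤-reflexive (+-suc (length l) (suc (length r)))) (n≤1+n _)
  cells-move R (tape l b [])      = ≤-refl
  cells-move R (tape l b (a ∷ r)) =
    ≤-trans (≤-reflexive (sym (+-suc (length l) (suc (length r))))) (n≤1+n _)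

  cells-execute : ∀ k i t → cells (content (execute k i t)) ≤ suc (cells t)
  cells-execute k (go d)   t            = cells-move d t
  cells-execute k mark     t@(tape _ _ _) = n≤1+n _
  cells-execute k (jump x) t            = n≤1+n _

  cells-run : ∀ n {c c′} → run stepW n c ≡ just c′ → cells (content c′) ≤ n + cells (content c)
  cells-run zero refl = ≤-refl
  cells-run (suc n) {config i t} r with lower i
  ... | just k = ≤-trans (cells-run n {execute k (lookup program k) t} r)
    (≤-trans (+-monoʳ-≤ n (cells-execute k (lookup program k) t))
      (≤-reflexive (+-suc n (cells t))))

-- A queue on a non-erasing tape

-- Here l starts with the scanned cell.
tapeAt : List Bool → List Bool → Tape
tapeAt []      r = tape [] false r
tapeAt (b ∷ l) r = tape l b r

blanks : ℕ → List Bool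
blanks n = replicate n false

blanks-+ : ∀ m n → blanks (m + n) ≡ blanks m ++ blanks n
blanks-+ zero    n = refl
blanks-+ (suc m) n = cong (false ∷_) (blanks-+ m n)

∷ʳ-blanks : ∀ n → blanks n ++ [ false ] ≡ blanks (suc n)
∷ʳ-blanks n = trans (sym (blanks-+ n 1)) (cong blanks (+-comm n 1))

skip : ∀ {Label} → Direction → Op Label
skip d = op d next false

test : ∀ {Label} → Direction → Label → Op Label
test d l = op d (label l) false

put : ∀ {Label} → Direction → Op Label
put d = op d next true

skips : ∀ {Label} → Direction → ℕ → List (Op Label) → List (Op Label)
skips d zero    os = os
skips d (suc n) os = skip d ∷ skips d n os

module Feeding {P S : Set} (δ : P → S → Maybe (P × List S)) where

  -- Before the end symbol each symbol read is answered by exactly one symbol written, so the queue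
  -- keeps its length.
  data Feeds : P → List S → P → List S → Set where
    []  : ∀ {p} → Feeds p [] p []
    _∷_ : ∀ {p x q y xs r ys} → δ p x ≡ just (q , [ y ]) → Feeds q xs r ys →
          Feeds p (x ∷ xs) r (y ∷ ys)

  _⊕_ : ∀ {p xs q ys xs′ r ys′} → Feeds p xs q ys → Feeds q xs′ r ys′ →
        Feeds p (xs ++ xs′) r (ys ++ ys′)
  []       ⊕ ψ = ψ
  (eq ∷ φ) ⊕ ψ = eq ∷ (φ ⊕ ψ)

  feeds-length : ∀ {p ws q vs} → Feeds p ws q vs → length vs ≡ length ws
  feeds-length []      = refl
  feeds-length (_ ∷ φ) = cong suc (feeds-length φ)

module Queue {P S : Set} (δ : P → S → Maybe (P × List S))
             (p₀ : P) (memories : List P) (memory-∈ : ∀ p → p ∈ˡ p₀ ∷ memories)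
             (first : memory-∈ p₀ ≡ here refl)
             (symbols : List S) (symbol-∈ : ∀ x → x ∈ˡ symbols) where

  open Feeding δ

  before after : S → List S
  before x = proj₁ (∈-∃++ (symbol-∈ x))
  after  x = proj₁ (proj₂ (∈-∃++ (symbol-∈ x)))

  symbols-split : ∀ x → symbols ≡ before x ++ x ∷ after x
  symbols-split x = proj₂ (proj₂ (∈-∃++ (symbol-∈ x)))

  s : ℕ
  s = length symbols

  onehot : S → List Bool
  onehot x = blanks (length (before x)) ++ true ∷ blanks (length (after x))

  s-split : ∀ x → s ≡ length (before x) + suc (length (after x))
  s-split x = trans (cong length (symbols-split x)) (length-++ (before x))

  length-onehot : ∀ x → length (onehot x) ≡ s
  length-onehot x = begin
    length (onehot x)                             ≡⟨ length-++ (blanks b) ⟩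
    length (blanks b) + suc (length (blanks a))   ≡⟨ cong₂ (λ i j → i + suc j) (length-replicate b) (length-replicate a) ⟩
    b + suc a                                     ≡⟨ s-split x ⟨
    s                                             ∎
    where
    open ≡-Reasoning
    b a : ℕ
    b = length (before x)
    a = length (after x)

  -- A symbol occupies s + 2 cells: a flag, which becomes 1 when the symbol is
  -- popped, the one-hot code of the symbol, and a cell containing 1.
  block : Bool → S → List Bool
  block f x = f ∷ onehot x ++ [ true ]

  blocks : List S → List Bool
  blocks = concatMap (block false)

  -- Listed explicitly behind the queue: the travelling head inspects its last cell to notice that
  -- the queue has ended, and each cycle leaves exactly these blanks listed again.
  freeBlock : List Bool
  freeBlock = blanks (2 + s)

  data Label : Set where
    pop back   : P → Label
    got travel : P → S → Label

  onRead : P → S → Target Label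
  onRead p x = maybe′ (λ _ → label (got p x)) halt (δ p x)

  readCode : P → List S → List (Op Label)
  readCode p []       = []
  readCode p (x ∷ xs) = op R (onRead p x) false ∷ readCode p xs

  -- Starts on the last cell of a free block. Going `length (after y) + 1` cells left reaches the
  -- one-hot cell of `y`; the same distance back reaches the last cell, whose 1 completes the block;
  -- `2 + s` cells further lies the last cell of the next free block.
  push : List S → List (Op Label) → List (Op Label)
  push []       os = os
  push (y ∷ ys) os = skips L (length (after y)) (put L ∷
    skips R (length (after y)) (put R ∷ skips R (2 + s) (push ys os)))

  answer : Maybe (P × List S) → List (Op Label)
  answer nothing         = []
  answer (just (p , ys)) = push ys (skips L (suc s) (test L (back p) ∷ []))

  -- The head is on the flag of the last popped block at pop, on the one-hot
  -- cell containing 1 at got, and on the last cell of a block at travel and back.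
  code : Label → List (Op Label)
  code (pop p)      = skips R (suc s) (put R ∷ readCode p symbols)
  code (got p x)    = skips R (length (after x)) (test R (travel p x) ∷ [])
  code (travel p x) = skips R (suc s) (test R (travel p x) ∷ answer (δ p x))
  code (back p)     = skips L s (test L (pop p) ∷ test L (back p) ∷ [])

  labels : List Label
  labels = map pop (p₀ ∷ memories) ++ map back (p₀ ∷ memories) ++
           cartesianProductWith got (p₀ ∷ memories) symbols ++
           cartesianProductWith travel (p₀ ∷ memories) symbols

  label-∈ : ∀ l → l ∈ˡ labels
  label-∈ (pop p)      = ∈-++⁺ˡ (∈-map⁺ pop (memory-∈ p))
  label-∈ (back p)     = ∈-++⁺ʳ (map pop (p₀ ∷ memories)) (∈-++⁺ˡ (∈-map⁺ back (memory-∈ p)))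
  label-∈ (got p x)    = ∈-++⁺ʳ (map pop (p₀ ∷ memories)) (∈-++⁺ʳ (map back (p₀ ∷ memories))
    (∈-++⁺ˡ (∈-cartesianProductWith⁺ got (memory-∈ p) (symbol-∈ x))))
  label-∈ (travel p x) = ∈-++⁺ʳ (map pop (p₀ ∷ memories)) (∈-++⁺ʳ (map back (p₀ ∷ memories))
    (∈-++⁺ʳ (cartesianProductWith got (p₀ ∷ memories) symbols)
      (∈-cartesianProductWith⁺ travel (memory-∈ p) (symbol-∈ x))))

  open Programs code labels label-∈ public

  -- What the parameter `first` is for: the initial control is the one in which every pass begins,
  -- so the initial and the later configurations are decoded alike.
  start-first : start (pop p₀) ≡ zero
  start-first = cong (λ i → startIn {ls = labels} (∈-++⁺ˡ (∈-map⁺ pop i))) first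

  -- Runs of the queue program

  infix 4 _∣_∣_⟶[_]_∣_∣_ _∣_∣_⟶⁺[_]_∣_∣_

  -- A record and not an abbreviation: `tapeAt` is a function, from whose value the two lists could
  -- not be inferred.
  record _∣_∣_⟶[_]_∣_∣_ (c : Control) (l r : List Bool) (n : ℕ)
                        (c′ : Control) (l′ r′ : List Bool) : Set where
    constructor path
    field reach : Reach n (c , tapeAt l r) (c′ , tapeAt l′ r′)

  record _∣_∣_⟶⁺[_]_∣_∣_ (c : Control) (l r : List Bool) (n : ℕ)
                         (c′ : Control) (l′ r′ : List Bool) : Set where
    constructor path
    field reach : Reach⁺ n (c , tapeAt l r) (c′ , tapeAt l′ r′)

  module _ {c c′ : Control} {l r l′ r′ : List Bool} {n : ℕ} where

    plus : c ∣ l ∣ r ⟶⁺[ n ] c′ ∣ l′ ∣ r′ → c ∣ l ∣ r ⟶[ n ] c′ ∣ l′ ∣ r′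
    plus (path ρ) = path (some ρ)

    within : ∀ {m} → n ≤ m → c ∣ l ∣ r ⟶[ n ] c′ ∣ l′ ∣ r′ → c ∣ l ∣ r ⟶[ m ] c′ ∣ l′ ∣ r′
    within n≤m (path ρ) = path (weaken n≤m ρ)

    within⁺ : ∀ {m} → n ≤ m → c ∣ l ∣ r ⟶⁺[ n ] c′ ∣ l′ ∣ r′ → c ∣ l ∣ r ⟶⁺[ m ] c′ ∣ l′ ∣ r′
    within⁺ n≤m (path ρ) = path (weaken⁺ n≤m ρ)

    recast : ∀ {l₁ r₁ l₁′ r₁′} → l ≡ l₁ → r ≡ r₁ → l′ ≡ l₁′ → r′ ≡ r₁′ →
             c ∣ l ∣ r ⟶⁺[ n ] c′ ∣ l′ ∣ r′ → c ∣ l₁ ∣ r₁ ⟶⁺[ n ] c′ ∣ l₁′ ∣ r₁′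
    recast refl refl refl refl π = π

    infixr 5 _▹⁺_ _▹_

    _▹⁺_ : ∀ {m c″ l″ r″} → c ∣ l ∣ r ⟶⁺[ n ] c′ ∣ l′ ∣ r′ → c′ ∣ l′ ∣ r′ ⟶[ m ] c″ ∣ l″ ∣ r″ →
           c ∣ l ∣ r ⟶⁺[ n + m ] c″ ∣ l″ ∣ r″
    path ρ ▹⁺ path σ = path (ρ ◅◅⁺ σ)

    _▹_ : ∀ {m c″ l″ r″} → c ∣ l ∣ r ⟶[ n ] c′ ∣ l′ ∣ r′ → c′ ∣ l′ ∣ r′ ⟶[ m ] c″ ∣ l″ ∣ r″ →
          c ∣ l ∣ r ⟶[ n + m ] c″ ∣ l″ ∣ r″
    path ρ ▹ path σ = path (ρ ◅◅ σ)

  infixr 5 _▸⁺_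

  _▸⁺_ : ∀ {c l r m c′ l′ r′ n c″ l″ r″} →
         c ∣ l ∣ r ⟶[ m ] c′ ∣ l′ ∣ r′ → c′ ∣ l′ ∣ r′ ⟶⁺[ n ] c″ ∣ l″ ∣ r″ →
         c ∣ l ∣ r ⟶⁺[ m + n ] c″ ∣ l″ ∣ r″
  _▸⁺_ {m = m} {n = n} (path ρ) (path σ) = path (join ρ σ)
    where
    join : ∀ {s s′ s″} → Reach m s s′ → Reach⁺ n s′ s″ → Reach⁺ (m + n) s s″
    join stay      σ = weaken⁺ (m≤n+m n m) σ
    join (some ρ′) σ = ρ′ ◅◅⁺ some σ

  enter : ∀ k {l r n c′ l′ r′} →
          ops (code k) ∣ l ∣ r ⟶⁺[ n ] c′ ∣ l′ ∣ r′ → entry k ∣ l ∣ r ⟶⁺[ n ] c′ ∣ l′ ∣ r′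
  enter _ (path (perform-first eq ρ)) = path (perform-first eq ρ)

  perform-skip : ∀ d os t → perform (skip d) os t ≡ (ops os , move d t)
  perform-skip d os t with scanned (move d t) in eq
  ... | true  = refl
  ... | false = cong (ops os ,_) (write-scanned (move d t) eq)

  skip-one : ∀ {n d os t s} → Reach n (ops os , move d t) s → Reach⁺ (suc n) (ops (skip d ∷ os) , t) s
  skip-one {n} {d} {os} {t} ρ =
    perform-first refl (subst (λ s → Reach n s _) (sym (perform-skip d os t)) ρ)

  skip-blanks : ∀ n {os k l} →
    ops (skips R n os) ∣ k ∷ l ∣ [] ⟶[ n ] ops os ∣ blanks n ʳ++ (k ∷ l) ∣ []
  skip-blanks zero    = path stay
  skip-blanks (suc n) with path ρ ← skip-blanks n = path (some (skip-one ρ))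

  go-right-1 : ∀ {n} cs → n ≡ length cs → ∀ {x b os k l r} →
    ops (skips R n (op R x b ∷ os)) ∣ k ∷ l ∣ cs ++ true ∷ r
      ⟶⁺[ suc n ] follow x os ∣ true ∷ (cs ʳ++ (k ∷ l)) ∣ r
  go-right-1 [] refl = path (perform-first refl stay)
  go-right-1 (_ ∷ cs) refl with path ρ ← go-right-1 cs refl = path (skip-one (some ρ))

  go-right-0 : ∀ {n} cs → n ≡ length cs → ∀ {x b os k l r} →
    ops (skips R n (op R x b ∷ os)) ∣ k ∷ l ∣ cs ++ false ∷ r
      ⟶⁺[ suc n ] ops os ∣ b ∷ (cs ʳ++ (k ∷ l)) ∣ r
  go-right-0 [] refl = path (perform-first refl stay)
  go-right-0 (_ ∷ cs) refl with path ρ ← go-right-0 cs refl = path (skip-one (some ρ))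

  leftwards-1 : ∀ cs {x b os k l r} →
    ops (skips L (length cs) (op L x b ∷ os)) ∣ k ∷ cs ++ true ∷ l ∣ r
      ⟶⁺[ suc (length cs) ] follow x os ∣ true ∷ l ∣ cs ʳ++ (k ∷ r)
  leftwards-1 [] = path (perform-first refl stay)
  leftwards-1 (_ ∷ cs) with path ρ ← leftwards-1 cs = path (skip-one (some ρ))

  leftwards-0 : ∀ cs {x b os k l r} →
    ops (skips L (length cs) (op L x b ∷ os)) ∣ k ∷ cs ++ false ∷ l ∣ r
      ⟶⁺[ suc (length cs) ] ops os ∣ b ∷ l ∣ cs ʳ++ (k ∷ r)
  leftwards-0 [] = path (perform-first refl stay)
  leftwards-0 (_ ∷ cs) with path ρ ← leftwards-0 cs = path (skip-one (some ρ))

  ∷ʳ-ʳ++ : ∀ (cs : List Bool) k {l} → k ∷ reverse cs ++ l ≡ (cs ++ [ k ]) ʳ++ l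
  ∷ʳ-ʳ++ cs k {l} = sym (trans (++-ʳ++ cs) (cong (k ∷_) (ʳ++-defn cs)))

  -- The left side has the form `cs ʳ++ l` with `cs` in reading order, so a block looks the same on
  -- either side of the head. The walk itself runs through the reversed list.
  go-left-1 : ∀ {n} cs → n ≡ length cs → ∀ {x b os k l r} →
    ops (skips L n (op L x b ∷ os)) ∣ (cs ++ [ k ]) ʳ++ (true ∷ l) ∣ r
      ⟶⁺[ suc n ] follow x os ∣ true ∷ l ∣ cs ++ k ∷ r
  go-left-1 cs n≡ {k = k} rewrite trans n≡ (sym (length-reverse cs)) =
    recast (∷ʳ-ʳ++ cs k) refl refl (ʳ++-ʳ++ cs) (leftwards-1 (reverse cs))

  go-left-0 : ∀ {n} cs → n ≡ length cs → ∀ {x b os k l r} →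
    ops (skips L n (op L x b ∷ os)) ∣ (cs ++ [ k ]) ʳ++ (false ∷ l) ∣ r
      ⟶⁺[ suc n ] ops os ∣ b ∷ l ∣ cs ++ k ∷ r
  go-left-0 cs n≡ {k = k} rewrite trans n≡ (sym (length-reverse cs)) =
    recast (∷ʳ-ʳ++ cs k) refl refl (ʳ++-ʳ++ cs) (leftwards-0 (reverse cs))

  unit : ℕ
  unit = 2 + s

  length-∷ʳ : ∀ (xs : List Bool) y → length (xs ++ [ y ]) ≡ suc (length xs)
  length-∷ʳ xs y = trans (length-++ xs) (+-comm (length xs) 1)

  length-tail : ∀ z → suc s ≡ length (onehot z ++ [ true ])
  length-tail z = trans (cong suc (sym (length-onehot z))) (sym (length-∷ʳ (onehot z) true))

  -- Cuts the blanks at the one-hot cell where `push` writes. Moving one of the blanks behind it to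
  -- the far end then exposes the last cell as well.
  freeBlock-split : ∀ x → freeBlock ≡
    false ∷ blanks (length (before x)) ++ false ∷ false ∷ blanks (length (after x))
  freeBlock-split x = begin
    blanks (2 + s)                      ≡⟨ cong (λ n → blanks (2 + n)) (s-split x) ⟩
    blanks (2 + (b + suc a))            ≡⟨ cong (λ n → blanks (suc n)) (+-suc b (suc a)) ⟨
    false ∷ blanks (b + suc (suc a))    ≡⟨ cong (false ∷_) (blanks-+ b (suc (suc a))) ⟩
    false ∷ blanks b ++ false ∷ false ∷ blanks a ∎
    where
    open ≡-Reasoning
    b a : ℕ
    b = length (before x)
    a = length (after x)

  block-ʳ++ : ∀ f x {l} → true ∷ (onehot x ʳ++ (f ∷ l)) ≡ block f x ʳ++ l
  block-ʳ++ f x = sym (++-ʳ++ (onehot x))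

  onehot-ʳ++ : ∀ x {l} →
    blanks (length (after x)) ʳ++ (true ∷ (blanks (length (before x)) ʳ++ l)) ≡ onehot x ʳ++ l
  onehot-ʳ++ x = sym (++-ʳ++ (blanks (length (before x))))

  block-++ : ∀ f x r → (f ∷ onehot x) ++ true ∷ r ≡ block f x ++ r
  block-++ f x r = cong (f ∷_) (sym (++-assoc (onehot x) [ true ] r))

  blocks-∷-++ : ∀ x xs r → (false ∷ onehot x) ++ true ∷ (blocks xs ++ r) ≡ blocks (x ∷ xs) ++ r
  blocks-∷-++ x xs r = trans (block-++ false x (blocks xs ++ r))
    (sym (++-assoc (block false x) (blocks xs) r))

  read : ∀ p bs x as {ys k l r} → ys ≡ bs ++ x ∷ as →
    ops (readCode p ys) ∣ k ∷ l ∣ blanks (length bs) ++ true ∷ r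
      ⟶⁺[ suc (length bs) ]
    follow (onRead p x) (readCode p as) ∣ true ∷ (blanks (length bs) ʳ++ (k ∷ l)) ∣ r
  read p [] x as refl = path (perform-first refl stay)
  read p (_ ∷ bs) x as refl with path ρ ← read p bs x as refl = path (perform-first refl (some ρ))

  read-symbol : ∀ p x {k l r} →
    ops (readCode p symbols) ∣ k ∷ l ∣ onehot x ++ r
      ⟶⁺[ suc (length (before x)) ]
    follow (onRead p x) (readCode p (after x))
      ∣ true ∷ (blanks (length (before x)) ʳ++ (k ∷ l)) ∣ blanks (length (after x)) ++ r
  read-symbol p x {r = r} =
    recast refl (sym (++-assoc (blanks (length (before x))) _ r)) refl refl
      (read p (before x) x (after x) (symbols-split x))

  pop-read : ∀ p x z {g r} →
    entry (pop p) ∣ true ∷ g ∣ (onehot z ++ [ true ]) ++ block false x ++ r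
      ⟶⁺[ suc (suc s) + suc (length (before x)) ]
    follow (onRead p x) (readCode p (after x))
      ∣ true ∷ (blanks (length (before x)) ʳ++ (true ∷ (block true z ʳ++ g)))
      ∣ blanks (length (after x)) ++ true ∷ r
  pop-read p x z {g} {r} =
    enter (pop p) (recast refl (cong (λ u → (onehot z ++ [ true ]) ++ u) (block-++ false x r)) refl refl
      (go-right-0 (onehot z ++ [ true ]) (length-tail z)))
    ▹⁺ plus (read-symbol p x)

  onRead-just : ∀ p x {q ys} → δ p x ≡ just (q , ys) → onRead p x ≡ label (got p x)
  onRead-just p x eq rewrite eq = refl

  onRead-nothing : ∀ p x → δ p x ≡ nothing → onRead p x ≡ halt
  onRead-nothing p x eq rewrite eq = refl

  pop-symbol : ∀ p x z {q ys g r} → δ p x ≡ just (q , ys) →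
    entry (pop p) ∣ true ∷ g ∣ (onehot z ++ [ true ]) ++ block false x ++ r
      ⟶⁺[ unit + unit ]
    entry (travel p x) ∣ block true x ʳ++ (block true z ʳ++ g) ∣ r
  pop-symbol p x z {g = g} {r} eq = within⁺ count
    (subst (λ y → entry (pop p) ∣ true ∷ g ∣ (onehot z ++ [ true ]) ++ block false x ++ r
                    ⟶⁺[ suc (suc s) + suc b ] follow y (readCode p (after x))
                    ∣ true ∷ (blanks b ʳ++ (true ∷ (block true z ʳ++ g))) ∣ blanks a ++ true ∷ r)
       (onRead-just p x eq) (pop-read p x z)
     ▹⁺ plus (enter (got p x) (recast refl refl
          (trans (cong (true ∷_) (onehot-ʳ++ x)) (block-ʳ++ true x)) refl
          (go-right-1 (blanks a) (sym (length-replicate a))))))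
    where
    b a : ℕ
    b = length (before x)
    a = length (after x)
    -- The first summand leads to the flag of the block of `x`, the second to the 1 of its code, the
    -- third to the 1 at its end.
    count : suc (suc s) + suc b + suc a ≤ unit + unit
    count = ≤-trans (≤-reflexive (+-assoc unit (suc b) (suc a)))
      (+-monoʳ-≤ unit (s≤s (≤-trans (≤-reflexive (sym (s-split x))) (n≤1+n s))))

  pop-halts : ∀ p x z {g r} → δ p x ≡ nothing → ∃[ l ] ∃[ r′ ]
    entry (pop p) ∣ true ∷ g ∣ (onehot z ++ [ true ]) ++ block false x ++ r
      ⟶⁺[ unit + unit ] halted ∣ l ∣ r′
  pop-halts p x z {g} {r} eq = _ , _ , within⁺ (+-monoʳ-≤ unit count)
    (subst (λ y → entry (pop p) ∣ true ∷ g ∣ (onehot z ++ [ true ]) ++ block false x ++ r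
                    ⟶⁺[ suc (suc s) + suc b ] follow y (readCode p (after x))
                    ∣ true ∷ (blanks b ʳ++ (true ∷ (block true z ʳ++ g))) ∣ _)
       (onRead-nothing p x eq) (pop-read p x z))
    where
    b : ℕ
    b = length (before x)
    count : suc b ≤ unit
    count = s≤s (≤-trans (m≤m+n b (suc (length (after x))))
      (≤-trans (≤-reflexive (sym (s-split x))) (n≤1+n s)))

  -- Each queued block ends in 1 and sends the head on; the first 0 found at such a place belongs to
  -- the free block.
  travel-over : ∀ p x xs {l} →
    entry (travel p x) ∣ true ∷ l ∣ blocks xs ++ freeBlock
      ⟶⁺[ suc (length xs) * unit ]
    ops (answer (δ p x)) ∣ freeBlock ʳ++ (blocks xs ʳ++ (true ∷ l)) ∣ []
  travel-over p x [] {l} = within⁺ (≤-reflexive (sym (+-identityʳ unit)))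
    (enter (travel p x) (recast refl (∷ʳ-blanks (suc s))
      (trans (sym (++-ʳ++ (blanks (suc s)))) (cong (_ʳ++ (true ∷ l)) (∷ʳ-blanks (suc s)))) refl
      (go-right-0 (blanks (suc s)) (sym (length-replicate (suc s))))))
  travel-over p x (y ∷ ys) {l} =
    enter (travel p x) (recast refl (blocks-∷-++ y ys freeBlock) refl refl
      (go-right-1 (false ∷ onehot y) (cong suc (sym (length-onehot y)))))
    ▹⁺ plus (recast refl refl (cong (freeBlock ʳ++_)
         (trans (cong (blocks ys ʳ++_) (block-ʳ++ false y)) (sym (++-ʳ++ (block false y))))) refl
         (travel-over p x ys))

  push-one : ∀ y {os l} →
    ops (push [ y ] os) ∣ freeBlock ʳ++ l ∣ []
      ⟶⁺[ 3 * unit ]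
    ops os ∣ freeBlock ʳ++ (block false y ʳ++ l) ∣ []
  push-one y {os} {l} = within⁺ count
    (recast
       (trans (cong (_ʳ++ (false ∷ m)) (∷ʳ-blanks a))
         (trans (sym (++-ʳ++ (blanks b))) (cong (_ʳ++ l) (sym (freeBlock-split y))))) refl
       refl (∷ʳ-blanks a)
       (go-left-0 (blanks a) (sym (length-replicate a)))
     ▹⁺ plus (recast refl (∷ʳ-blanks a)
          (cong (freeBlock ʳ++_) (trans (cong (true ∷_) (onehot-ʳ++ y)) (block-ʳ++ false y))) refl
          (go-right-0 (blanks a) (sym (length-replicate a)) ▹⁺ skip-blanks (2 + s))))
    where
    b a : ℕ
    b = length (before y)
    a = length (after y)
    m : List Bool
    m = blanks b ʳ++ (false ∷ l)
    count : suc a + (suc a + (2 + s)) ≤ 3 * unit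
    count = +-mono-≤ a≤ (+-mono-≤ a≤ (≤-reflexive (sym (+-identityʳ unit))))
      where
      a≤ : suc a ≤ unit
      a≤ = ≤-trans (m≤n+m (suc a) b) (≤-trans (≤-reflexive (sym (s-split y))) (m≤n+m s 2))

  push-all : ∀ ys {os l} →
    ops (push ys os) ∣ freeBlock ʳ++ l ∣ []
      ⟶[ length ys * (3 * unit) ]
    ops os ∣ freeBlock ʳ++ (blocks ys ʳ++ l) ∣ []
  push-all []       = path stay
  push-all (y ∷ ys) {os} {l} =
    subst (λ l′ → ops (push (y ∷ ys) os) ∣ freeBlock ʳ++ l ∣ [] ⟶[ suc (length ys) * (3 * unit) ]
                  ops os ∣ freeBlock ʳ++ l′ ∣ []) (sym (++-ʳ++ (block false y)))
      (plus (push-one y) ▹ push-all ys)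

  turn-back : ∀ q {l} →
    ops (skips L (suc s) (test L (back q) ∷ [])) ∣ freeBlock ʳ++ (true ∷ l) ∣ []
      ⟶⁺[ unit ] entry (back q) ∣ true ∷ l ∣ freeBlock
  turn-back q {l} = recast (cong (_ʳ++ (true ∷ l)) (∷ʳ-blanks (suc s))) refl refl (∷ʳ-blanks (suc s))
    (go-left-1 (blanks (suc s)) (sym (length-replicate (suc s))))

  back-popped : ∀ q x {l r} →
    entry (back q) ∣ block true x ʳ++ l ∣ r
      ⟶⁺[ suc s ] entry (pop q) ∣ true ∷ l ∣ onehot x ++ true ∷ r
  back-popped q x = enter (back q) (go-left-1 (onehot x) (sym (length-onehot x)))

  back-unpopped : ∀ q x {l r} →
    entry (back q) ∣ block false x ʳ++ (true ∷ l) ∣ r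
      ⟶⁺[ suc s + 1 ] entry (back q) ∣ true ∷ l ∣ block false x ++ r
  back-unpopped q x {r = r} = recast refl refl refl (block-++ false x r)
    (enter (back q) (go-left-0 (onehot x) (sym (length-onehot x)))
     ▹⁺ path (some (perform-first refl stay)))

  back-over : ∀ q xs {l r} →
    entry (back q) ∣ blocks xs ʳ++ (true ∷ l) ∣ r
      ⟶[ length xs * unit ] entry (back q) ∣ true ∷ l ∣ blocks xs ++ r
  back-over q []       = path stay
  back-over q (x ∷ xs) {l} {r} = within (≤-reflexive (+-comm (length xs * unit) unit))
    (from-left (trans (cong (blocks xs ʳ++_) (block-ʳ++ false x)) (sym (++-ʳ++ (block false x))))
      (back-over q xs)
     ▹ within (≤-reflexive (+-comm (suc s) 1)) (plus (recast (sym (block-ʳ++ false x)) refl refl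
         (sym (++-assoc (block false x) (blocks xs) r)) (back-unpopped q x))))
    where
    from-left : ∀ {l r l′ r′ l₁ n} → l ≡ l₁ →
      entry (back q) ∣ l ∣ r ⟶[ n ] entry (back q) ∣ l′ ∣ r′ →
      entry (back q) ∣ l₁ ∣ r ⟶[ n ] entry (back q) ∣ l′ ∣ r′
    from-left refl π = π

  -- The cell before the free block contains 1 in every case: it ends the last queued block or, if
  -- the queue is empty, the block just popped. So the jump that turns the head back is always
  -- taken.
  blocks-mark : ∀ xs {l} → ∃[ l′ ] blocks xs ʳ++ (true ∷ l) ≡ true ∷ l′
  blocks-mark []       = _ , refl
  blocks-mark (x ∷ xs) {l} =
    let l′ , eq = blocks-mark xs {onehot x ʳ++ (false ∷ true ∷ l)}
    in l′ , trans (++-ʳ++ (block false x)) (trans (cong (blocks xs ʳ++_) (sym (block-ʳ++ false x))) eq)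

  return : ∀ q xs {l} →
    ops (skips L (suc s) (test L (back q) ∷ [])) ∣ freeBlock ʳ++ (blocks xs ʳ++ (true ∷ l)) ∣ []
      ⟶⁺[ unit + length xs * unit ] entry (back q) ∣ true ∷ l ∣ blocks xs ++ freeBlock
  return q xs {l} with l′ , eq ← blocks-mark xs {l} | back-over q xs {l} {freeBlock}
  ... | over rewrite eq = turn-back q ▹⁺ over

  queueTail : S → List S → List Bool
  queueTail z xs = (onehot z ++ [ true ]) ++ blocks xs ++ freeBlock

  abstract
    -- In block lengths, with `n` symbols behind the popped one: 2 to pop, `n + 1` to travel, 9 to
    -- push at most three symbols, `n + 4` to return to the popped block and 1 to reach its flag.
    -- Kept abstract so that the estimates do not unfold it.
    popCost : ℕ → ℕ
    popCost n = (17 + 2 * n) * unit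

    popCost-≡ : ∀ n → popCost n ≡ (17 + 2 * n) * unit
    popCost-≡ n = refl

    popCost-mono : ∀ {m n} → m ≤ n → popCost m ≤ popCost n
    popCost-mono m≤n = *-monoˡ-≤ unit (+-monoʳ-≤ 17 (*-monoʳ-≤ 2 m≤n))

  cycle-count : ∀ m n u → n ≤ 3 →
    (u + u) + (suc m * u + (n * (3 * u) + ((u + (m + n) * u) + u))) ≤ (17 + 2 * m) * u
  cycle-count m n u n≤3 = ≤-trans
    (+-monoʳ-≤ (u + u) (+-monoʳ-≤ (suc m * u) (+-mono-≤ (*-monoˡ-≤ (3 * u) n≤3)
      (+-monoˡ-≤ u (+-monoʳ-≤ u (*-monoˡ-≤ u (+-monoʳ-≤ m n≤3)))))))
    (≤-reflexive (total m u))
    where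
    total : ∀ m u → (u + u) + (suc m * u + (3 * (3 * u) + ((u + (m + 3) * u) + u))) ≡ (17 + 2 * m) * u
    total = solve-∀

  pop-push : ∀ {p x q ys} → δ p x ≡ just (q , ys) → length ys ≤ 3 → ∀ z xs {g} →
    entry (pop p) ∣ true ∷ g ∣ queueTail z (x ∷ xs)
      ⟶⁺[ popCost (length xs) ]
    entry (pop q) ∣ true ∷ (block true z ʳ++ g) ∣ queueTail x (xs ++ ys)
  pop-push {p} {x} {q} {ys} eq ys≤3 z xs {g} = within⁺ count
    (recast refl (cong ((onehot z ++ [ true ]) ++_) (sym (++-assoc (block false x) (blocks xs) freeBlock)))
       (sym (block-ʳ++ true x)) refl (pop-symbol p x z eq)
     ▹⁺ subst (λ a → entry (travel p x) ∣ true ∷ m ∣ blocks xs ++ freeBlock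
                        ⟶[ suc (length xs) * unit ] ops (answer a)
                        ∣ freeBlock ʳ++ (blocks xs ʳ++ (true ∷ m)) ∣ []) eq
          (plus (travel-over p x xs))
     ▹ push-all ys
     ▹ plus (recast
         (cong (freeBlock ʳ++_) (trans (cong (_ʳ++ (true ∷ m)) (concatMap-++ (block false) xs ys))
           (++-ʳ++ (blocks xs)))) refl (block-ʳ++ true x) refl
         (return q (xs ++ ys))
       ▹⁺ plus (recast refl refl refl (sym (++-assoc (onehot x) [ true ] _)) (back-popped q x))))
    where
    m : List Bool
    m = onehot x ʳ++ (true ∷ (block true z ʳ++ g))
    count : (unit + unit) + (suc (length xs) * unit + (length ys * (3 * unit) +
              ((unit + length (xs ++ ys) * unit) + suc s))) ≤ popCost (length xs)
    count = ≤-trans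
      (+-monoʳ-≤ (unit + unit) (+-monoʳ-≤ (suc (length xs) * unit)
        (+-monoʳ-≤ (length ys * (3 * unit))
          (+-mono-≤ (+-monoʳ-≤ unit (≤-reflexive (cong (_* unit) (length-++ xs)))) (n≤1+n (suc s))))))
      (≤-trans (cycle-count (length xs) (length ys) unit ys≤3)
        (≤-reflexive (sym (popCost-≡ (length xs)))))

  -- Pops and pushes alternate one for one, so the queue length, and with it the bound for a cycle,
  -- is the same throughout.
  feed : ∀ {p ws q vs} → Feeds p ws q vs → ∀ xs z {g} → ∃[ z′ ] ∃[ g′ ]
    entry (pop p) ∣ true ∷ g ∣ queueTail z (ws ++ xs)
      ⟶[ length ws * popCost (length (ws ++ xs)) ]
    entry (pop q) ∣ true ∷ g′ ∣ queueTail z′ (xs ++ vs)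
  feed [] xs z {g} = z , g , subst (λ u → _ ∣ true ∷ g ∣ queueTail z xs ⟶[ 0 ] _ ∣ true ∷ g ∣ queueTail z u)
                               (sym (++-identityʳ xs)) (path stay)
  feed {p} {w ∷ ws} {q} {v ∷ vs} (_∷_ {q = q₁} eq φ) xs z {g}
    with z′ , g′ , π ← feed φ (xs ++ [ v ]) w {block true z ʳ++ g} = z′ , g′ , within count
      (plus (pop-push eq (s≤s z≤n) z (ws ++ xs))
       ▹ subst₂ (λ u u′ → entry (pop q₁) ∣ true ∷ (block true z ʳ++ g) ∣ queueTail w u
                   ⟶[ length ws * popCost (length (ws ++ xs ++ [ v ])) ]
                   entry (pop q) ∣ true ∷ g′ ∣ queueTail z′ u′)
           (sym (++-assoc ws xs [ v ])) (++-assoc xs [ v ] vs) π)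
    where
    n : ℕ
    n = length (ws ++ xs)
    same : length (ws ++ xs ++ [ v ]) ≡ suc n
    same = trans (cong length (sym (++-assoc ws xs [ v ])))
             (trans (length-++ (ws ++ xs)) (+-comm n 1))
    count : popCost n + length ws * popCost (length (ws ++ xs ++ [ v ])) ≤
            popCost (suc n) + length ws * popCost (suc n)
    count = +-mono-≤ {popCost n} {popCost (suc n)} (popCost-mono (n≤1+n n))
              (≤-reflexive (cong (λ k → length ws * popCost k) same))

-- Removing outer blanks

module Trimming (n : ℕ) where

  Word : Set
  Word = List (Letter (Fin n))

  open WordTransducers (Letter (Fin n)) (Letter (Fin n))

  data Nonblank : Letter (Fin n) → Set where
    one  : Nonblank (cell true)
    head : ∀ q b → Nonblank (head q b)

  nonblanks alphabet : Word
  nonblanks = cell true ∷ cartesianProductWith head (allFin n) (false ∷ true ∷ [])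
  alphabet   = cell false ∷ nonblanks

  ∈-nonblanks⁺ : ∀ {x} → Nonblank x → x ∈ˡ nonblanks
  ∈-nonblanks⁺ one = here refl
  ∈-nonblanks⁺ (head q false) = there (∈-cartesianProductWith⁺ head (∈-allFin q) (here refl))
  ∈-nonblanks⁺ (head q true)  = there (∈-cartesianProductWith⁺ head (∈-allFin q) (there (here refl)))

  ∈-nonblanks⁻ : ∀ {x} → x ∈ˡ nonblanks → Nonblank x
  ∈-nonblanks⁻ (here refl) = one
  ∈-nonblanks⁻ (there x∈) with ∈-cartesianProductWith⁻ head (allFin n) (false ∷ true ∷ []) x∈
  ... | q , b , _ , _ , refl = head q b

  ∈-alphabet : ∀ x → x ∈ˡ alphabet
  ∈-alphabet (cell false) = here refl
  ∈-alphabet (cell true)  = there (∈-nonblanks⁺ one)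
  ∈-alphabet (head q b)   = there (∈-nonblanks⁺ (head q b))

  copies : ∀ {k} → Fin k → Word → Fin k → List (WordEdge k)
  copies p xs q = map (λ x → p , [ x ] , [ x ] , q) xs

  copies⁺ : ∀ {k x xs} {p q : Fin k} → x ∈ˡ xs → (p , [ x ] , [ x ] , q) ∈ˡ copies p xs q
  copies⁺ = ∈-map⁺ _

  ltrim : Word → Word
  ltrim (cell false ∷ u) = ltrim u
  ltrim u                = u

  ltrim-nonblank : ∀ {x} u → Nonblank x → ltrim (x ∷ u) ≡ x ∷ u
  ltrim-nonblank u one        = refl
  ltrim-nonblank u (head q b) = refl

  lcons : Letter (Fin n) → Word → Word
  lcons (cell false) [] = []
  lcons x            u  = x ∷ u

  rtrim : Word → Word
  rtrim []      = []
  rtrim (x ∷ u) = lcons x (rtrim u)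

  lcons-nonblank : ∀ {x} u → Nonblank x → lcons x u ≡ x ∷ u
  lcons-nonblank u one        = refl
  lcons-nonblank u (head q b) = refl

  lcons-nonempty : ∀ {u} → u ≢ [] → lcons (cell false) u ≡ cell false ∷ u
  lcons-nonempty {[]}    u≢[] = contradiction refl u≢[]
  lcons-nonempty {_ ∷ _} u≢[] = refl

  -- The padding must not survive decoding, since `configWord` is the shortest segment. A word of
  -- blanks alone is rejected, which is harmless: a configuration contains a head.
  leftTrimmer : WordTransducer
  leftTrimmer = record
    { states    = 2
    ; initial   = 0F
    ; final     = 1F
    ; wordEdges = (0F , [ cell false ] , [] , 0F) ∷ copies 0F nonblanks 1F ++ copies 1F alphabet 1F
    }

  -- The state is 1F after a nonblank letter has been copied and 2F when only
  -- blanks are to follow.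
  rightTrimmer : WordTransducer
  rightTrimmer = record
    { states    = 3
    ; initial   = 0F
    ; final     = 2F
    ; wordEdges = (0F , [ cell false ] , [ cell false ] , 0F) ∷
                  (1F , [ cell false ] , [ cell false ] , 0F) ∷
                  (1F , [] , [] , 2F) ∷
                  (2F , [ cell false ] , [] , 2F) ∷
                  copies 0F nonblanks 1F ++ copies 1F nonblanks 1F
    }

  private
    module Left  = WordTransducer leftTrimmer
    module Right = WordTransducer rightTrimmer

  left₁-sound : ∀ {u v} → WordPath Left.Edge 1F u v 1F → v ≡ u
  left₁-sound done = refl
  left₁-sound (step (there e) π) with ∈-++⁻ (copies 0F nonblanks 1F) e
  left₁-sound (step (there e) π) | inj₁ e′ with () ← proj₂ (proj₂ (∈-map⁻ _ e′))
  left₁-sound (step (there e) π) | inj₂ e′ with _ , _ , refl ← ∈-map⁻ _ e′ =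
    cong (_ ∷_) (left₁-sound π)

  left-sound : ∀ {u v} → Left.Accepts u v → v ≡ ltrim u
  left-sound (step (here refl) π) = left-sound π
  left-sound (step (there e) π) with ∈-++⁻ (copies 0F nonblanks 1F) e
  left-sound (step (there e) π) | inj₁ e′ with _ , x∈ , refl ← ∈-map⁻ _ e′ =
    trans (cong (_ ∷_) (left₁-sound π)) (sym (ltrim-nonblank _ (∈-nonblanks⁻ x∈)))
  left-sound (step (there e) π) | inj₂ e′ with () ← proj₂ (proj₂ (∈-map⁻ _ e′))

  left₁-complete : ∀ u → WordPath Left.Edge 1F u u 1F
  left₁-complete []      = done
  left₁-complete (x ∷ u) =
    step (there (∈-++⁺ʳ (copies 0F nonblanks 1F) (copies⁺ (∈-alphabet x)))) (left₁-complete u)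

  left-complete : ∀ u → ltrim u ≢ [] → Left.Accepts u (ltrim u)
  left-complete [] ≢[] = contradiction refl ≢[]
  left-complete (cell false ∷ u) ≢[] = step (here refl) (left-complete u ≢[])
  left-complete (cell true ∷ u)  ≢[] =
    step (there (∈-++⁺ˡ (copies⁺ (∈-nonblanks⁺ one)))) (left₁-complete u)
  left-complete (head q b ∷ u)   ≢[] =
    step (there (∈-++⁺ˡ (copies⁺ (∈-nonblanks⁺ (head q b))))) (left₁-complete u)

  private
    nonblank-edge : ∀ {p xs ys q} → (p , xs , ys , q) ∈ˡ copies 0F nonblanks 1F ++ copies 1F nonblanks 1F →
                    ∃[ x ] (Nonblank x × xs ≡ [ x ] × ys ≡ [ x ] × q ≡ 1F × p ≢ 2F)
    nonblank-edge e with ∈-++⁻ (copies {3} 0F nonblanks 1F) e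
    ... | inj₁ e′ with x , x∈ , refl ← ∈-map⁻ _ e′ = x , ∈-nonblanks⁻ x∈ , refl , refl , refl , λ ()
    ... | inj₂ e′ with x , x∈ , refl ← ∈-map⁻ _ e′ = x , ∈-nonblanks⁻ x∈ , refl , refl , refl , λ ()

  right₂-sound : ∀ {u v} → WordPath Right.Edge 2F u v 2F → v ≡ [] × rtrim u ≡ []
  right₂-sound done = refl , refl
  right₂-sound (step (there (there (there (here refl)))) π)
    with refl , eq ← right₂-sound π rewrite eq = refl , refl
  right₂-sound (step (there (there (there (there e)))) π)
    with _ , _ , _ , _ , _ , ≢2 ← nonblank-edge e = contradiction refl ≢2

  -- The claim `v ≢ []` justifies the blanks copied in state `0F`: `rtrim` keeps a blank only if
  -- something remains behind it.
  right-sound : ∀ {u v} → Right.Accepts u v → v ≡ rtrim u × v ≢ []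
  right₁-sound : ∀ {u v} → WordPath Right.Edge 1F u v 2F → v ≡ rtrim u

  right-sound (step (here refl) π) with refl , v≢[] ← right-sound π =
    sym (lcons-nonempty v≢[]) , λ ()
  right-sound (step (there (there (there (there e)))) π)
    with x , nb , refl , refl , refl , _ ← nonblank-edge e =
    trans (cong (x ∷_) (right₁-sound π)) (sym (lcons-nonblank _ nb)) , λ ()

  right₁-sound (step (there (here refl)) π) with refl , v≢[] ← right-sound π =
    sym (lcons-nonempty v≢[])
  right₁-sound (step (there (there (here refl))) π) with refl , eq ← right₂-sound π = sym eq
  right₁-sound (step (there (there (there (there e)))) π)
    with x , nb , refl , refl , refl , _ ← nonblank-edge e =
    trans (cong (x ∷_) (right₁-sound π)) (sym (lcons-nonblank _ nb))

  right₂-complete : ∀ u → rtrim u ≡ [] → WordPath Right.Edge 2F u [] 2F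
  right₂-complete [] eq = done
  right₂-complete (cell false ∷ u) eq with rtrim u in eq′
  ... | [] = step (there (there (there (here refl)))) (right₂-complete u eq′)

  right-complete : ∀ u → rtrim u ≢ [] → Right.Accepts u (rtrim u)
  right₁-complete : ∀ u → WordPath Right.Edge 1F u (rtrim u) 2F

  right-complete [] ≢[] = contradiction refl ≢[]
  right-complete (cell false ∷ u) ≢[] with rtrim u in eq
  ... | []    = contradiction refl ≢[]
  ... | x ∷ v = step (here refl)
    (subst (Right.Accepts u) eq (right-complete u λ eq′ → contradiction (trans (sym eq) eq′) λ ()))
  right-complete (cell true ∷ u) _ =
    step (there (there (there (there (∈-++⁺ˡ (copies⁺ (∈-nonblanks⁺ one))))))) (right₁-complete u)
  right-complete (head q b ∷ u) _ =
    step (there (there (there (there (∈-++⁺ˡ (copies⁺ (∈-nonblanks⁺ (head q b)))))))) (right₁-complete u)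

  right₁-complete [] = step (there (there (here refl))) done
  right₁-complete (cell false ∷ u) with rtrim u in eq
  ... | []    = step (there (there (here refl)))
                  (step (there (there (there (here refl)))) (right₂-complete u eq))
  ... | x ∷ v = step (there (here refl))
    (subst (Right.Accepts u) eq (right-complete u λ eq′ → contradiction (trans (sym eq) eq′) λ ()))
  right₁-complete (cell true ∷ u) =
    step (there (there (there (there (∈-++⁺ʳ (copies 0F nonblanks 1F) (copies⁺ (∈-nonblanks⁺ one)))))))
      (right₁-complete u)
  right₁-complete (head q b ∷ u) =
    step (there (there (there (there (∈-++⁺ʳ (copies 0F nonblanks 1F) (copies⁺ (∈-nonblanks⁺ (head q b))))))))
      (right₁-complete u)

  module Trim = Composition letter-≟ (toTransducer leftTrimmer) (toTransducer rightTrimmer)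

  trimmer : Transducer (Letter (Fin n)) (Letter (Fin n))
  trimmer = Trim.compose

  trimmer-functional : Transducer.Functional trimmer
  trimmer-functional = Trim.compose-functional
    (λ a b → trans (left-sound (transduces⁻ leftTrimmer a)) (sym (left-sound (transduces⁻ leftTrimmer b))))
    (λ a b → trans (proj₁ (right-sound (transduces⁻ rightTrimmer a)))
               (sym (proj₁ (right-sound (transduces⁻ rightTrimmer b)))))

  fullWord : Fin n → Tape → Word
  fullWord q (tape l b r) = map cell (reverse l) ++ head q b ∷ map cell r

  -- The far end of `l` comes first in the word. Without a 1 in `l` the trimming runs on into `w`;
  -- otherwise it stops before `w`, whence the two cases.
  ltrim-blank : ∀ l w → trim l ≡ [] → ltrim (map cell (reverse l) ++ w) ≡ ltrim w
  ltrim-cells : ∀ l w {a u} → trim l ≡ a ∷ u →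
                ltrim (map cell (reverse l) ++ w) ≡ map cell (reverse (trim l)) ++ w

  snoc-cells : ∀ b l (w : Word) → map cell (reverse (b ∷ l)) ++ w ≡ map cell (reverse l) ++ cell b ∷ w
  snoc-cells b l w rewrite unfold-reverse b l | map-++ (cell {Fin n}) (reverse l) [ b ] =
    ++-assoc (map cell (reverse l)) [ cell b ] w

  ltrim-blank [] w eq = refl
  ltrim-blank (false ∷ l) w eq with trim l in eq′
  ... | [] = trans (cong ltrim (snoc-cells false l w)) (ltrim-blank l (cell false ∷ w) eq′)

  ltrim-cells (false ∷ l) w eq with trim l in eq′
  ... | a ∷ u = trans (cong ltrim (snoc-cells false l w))
    (trans (ltrim-cells l (cell false ∷ w) eq′)
      (trans (cong (λ x → map cell (reverse x) ++ cell false ∷ w) eq′) (sym (snoc-cells false (a ∷ u) w))))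
  ltrim-cells (true ∷ l) w eq with trim l in eq′
  ... | []    = trans (cong ltrim (snoc-cells true l w)) (ltrim-blank l (cell true ∷ w) eq′)
  ... | a ∷ u = trans (cong ltrim (snoc-cells true l w))
    (trans (ltrim-cells l (cell true ∷ w) eq′)
      (trans (cong (λ x → map cell (reverse x) ++ cell true ∷ w) eq′) (sym (snoc-cells true (a ∷ u) w))))

  ltrim-word : ∀ q l b w → ltrim (map cell (reverse l) ++ head q b ∷ w) ≡
                           map cell (reverse (trim l)) ++ head q b ∷ w
  ltrim-word q l b w with trim l in eq
  ... | []    = ltrim-blank l (head q b ∷ w) eq
  ... | a ∷ u = trans (ltrim-cells l (head q b ∷ w) eq)
                  (cong (λ x → map cell (reverse x) ++ head q b ∷ w) eq)

  rtrim-cells : ∀ r → rtrim (map cell r) ≡ map cell (trim r)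
  rtrim-cells []          = refl
  rtrim-cells (true ∷ r)  = cong (cell true ∷_) (rtrim-cells r)
  rtrim-cells (false ∷ r) rewrite rtrim-cells r with trim r
  ... | []    = refl
  ... | _ ∷ _ = refl

  rtrim-word : ∀ q l b r → rtrim (map cell l ++ head q b ∷ map cell r) ≡
                           map cell l ++ head q b ∷ map cell (trim r)
  rtrim-word q []          b r = cong (head q b ∷_) (rtrim-cells r)
  rtrim-word q (true ∷ l)  b r = cong (cell true ∷_) (rtrim-word q l b r)
  rtrim-word q (false ∷ l) b r rewrite rtrim-word q l b r with l
  ... | []    = refl
  ... | _ ∷ _ = refl

  ++-head≢[] : ∀ (u : Word) {x w} → u ++ x ∷ w ≢ []
  ++-head≢[] []      ()
  ++-head≢[] (_ ∷ _) ()

  trimmer-word : ∀ q t → Transducer.Transduces trimmer (fullWord q t) (tapeWord q t)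
  trimmer-word q (tape l b r) = Trim.compose⁺
    (transduces⁺ leftTrimmer (subst (Left.Accepts _) left≡
      (left-complete _ λ eq → ++-head≢[] (map cell (reverse (trim l))) (trans (sym left≡) eq))))
    (transduces⁺ rightTrimmer (subst (Right.Accepts _) right≡
      (right-complete _ λ eq → ++-head≢[] (map cell (reverse (trim l))) (trans (sym right≡) eq))))
    where
    left≡ : ltrim (map cell (reverse l) ++ head q b ∷ map cell r) ≡
            map cell (reverse (trim l)) ++ head q b ∷ map cell r
    left≡ = ltrim-word q l b (map cell r)
    right≡ : rtrim (map cell (reverse (trim l)) ++ head q b ∷ map cell r) ≡
             map cell (reverse (trim l)) ++ head q b ∷ map cell (trim r)
    right≡ = rtrim-word q (reverse (trim l)) b r

-- Rewriting a configuration in one pass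

infix 4 _≈_

-- Equality up to outer blanks: the queue holds a padded copy, and the tape of `M` may list blanks
-- of its own.
record _≈_ (t u : Tape) : Set where
  constructor same
  field
    left≈    : trim (left t) ≡ trim (left u)
    scanned≈ : scanned t ≡ scanned u
    right≈   : trim (right t) ≡ trim (right u)

open _≈_

≈-trans : ∀ {t u v} → t ≈ u → u ≈ v → t ≈ v
≈-trans (same l s r) (same l′ s′ r′) = same (trans l l′) (trans s s′) (trans r r′)

tapeWord-≈ : ∀ {Q : Set} (q : Q) {t u} → t ≈ u → tapeWord q t ≡ tapeWord q u
tapeWord-≈ q {tape l b r} {tape l′ b r′} (same left≈ refl right≈) rewrite left≈ | right≈ = refl

nearest : List Bool → Bool
nearest []      = false
nearest (b ∷ _) = b

beyond : List Bool → List Bool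
beyond []       = []
beyond (_ ∷ bs) = bs

trim-cons : ∀ l → trim l ≡ cons (nearest l) (trim (beyond l))
trim-cons []      = refl
trim-cons (_ ∷ _) = refl

cons-injective : ∀ {a b u v} → cons a u ≡ cons b v → a ≡ b × u ≡ v
cons-injective {false} {false} {[]}    {[]}    refl = refl , refl
cons-injective {false} {false} {_ ∷ _} {_ ∷ _} refl = refl , refl
cons-injective {false} {true}  {[]}            ()
cons-injective {false} {true}  {_ ∷ _}         ()
cons-injective {true}  {false} {_}     {[]}    ()
cons-injective {true}  {false} {_}     {_ ∷ _} ()
cons-injective {true}  {true}                  refl = refl , refl

-- Through `nearest` and `beyond` an empty list acts as endless blanks, so `trim` determines the
-- cells one by one, although not the list.
trim-injective : ∀ l l′ → trim l ≡ trim l′ →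
                 nearest l ≡ nearest l′ × trim (beyond l) ≡ trim (beyond l′)
trim-injective l l′ eq = cons-injective (trans (sym (trim-cons l)) (trans eq (trim-cons l′)))

move-L : ∀ l b r → move L (tape l b r) ≡ tape (beyond l) (nearest l) (b ∷ r)
move-L []      b r = refl
move-L (_ ∷ _) b r = refl

move-R : ∀ l b r → move R (tape l b r) ≡ tape (b ∷ l) (nearest r) (beyond r)
move-R l b []      = refl
move-R l b (_ ∷ _) = refl

move-write-≈ : ∀ d b {t u} → t ≈ u → move d (write b t) ≈ move d (write b u)
move-write-≈ L b {tape l _ r} {tape l′ _ r′} (same left≈ _ right≈)
  rewrite move-L l b r | move-L l′ b r′ =
  let eq , eq′ = trim-injective l l′ left≈ in same eq′ eq (cong (cons b) right≈)
move-write-≈ R b {tape l _ r} {tape l′ _ r′} (same left≈ _ right≈)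
  rewrite move-R l b r | move-R l′ b r′ =
  let eq , eq′ = trim-injective r r′ right≈ in same (cong (cons b) left≈) eq eq′

trim-∷ʳ : ∀ l → trim (l ++ [ false ]) ≡ trim l
trim-∷ʳ []      = refl
trim-∷ʳ (b ∷ l) = cong (cons b) (trim-∷ʳ l)

trim-idem : ∀ l → trim (trim l) ≡ trim l
trim-idem []          = refl
trim-idem (true ∷ l)  = cong (true ∷_) (trim-idem l)
trim-idem (false ∷ l) with trim l | trim-idem l
... | []    | _  = refl
... | _ ∷ _ | eq = cong (cons false) eq

length-trim : ∀ l → length (trim l) ≤ length l
length-trim []          = z≤n
length-trim (true ∷ l)  = s≤s (length-trim l)
length-trim (false ∷ l) with trim l | length-trim l
... | []    | _ = z≤n
... | _ ∷ _ | p = s≤s p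

cells≤cells-move : ∀ d t → cells t ≤ cells (move d t)
cells≤cells-move L (tape []      b r) = n≤1+n _
cells≤cells-move L (tape (a ∷ l) b r) = ≤-reflexive (sym (+-suc (length l) (suc (length r))))
cells≤cells-move R (tape l b [])      = n≤1+n _
cells≤cells-move R (tape l b (a ∷ r)) = ≤-reflexive (+-suc (length l) (suc (length r)))

module Phases {n : ℕ} {P : Set} (δ : P → Maybe (Letter (Fin n)) → Maybe (P × List (Maybe (Letter (Fin n)))))
              (p₀ : P) where

  open Trimming n using (fullWord)
  open Feeding δ public

  Symbol : Set
  Symbol = Maybe (Letter (Fin n))

  cellSymbols : List Bool → List Symbol
  cellSymbols bs = map just (map cell bs)

  cellSymbols-++ : ∀ bs cs → cellSymbols (bs ++ cs) ≡ cellSymbols bs ++ cellSymbols cs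
  cellSymbols-++ bs cs = trans (cong (map just) (map-++ cell bs cs)) (map-++ just (map cell bs) (map cell cs))

  wordSymbols : Fin n → Tape → List Symbol
  wordSymbols q t = map just (fullWord q t)

  wordSymbols-≡ : ∀ q l b r → wordSymbols q (tape l b r) ≡
                  cellSymbols (reverse l) ++ just (head q b) ∷ cellSymbols r
  wordSymbols-≡ q l b r = map-++ just (map cell (reverse l)) (head q b ∷ map cell r)

  -- The three closing symbols answer the end symbol; by `result`, the last of them is the end
  -- symbol of the next configuration.
  record Phase (q : Fin n) (t : Tape) (q′ : Fin n) (t′ : Tape) : Set where
    field
      {memory}         : P
      {output closing} : List Symbol
      padded          : Tape
      padded≈         : padded ≈ t′
      feeds           : Feeds p₀ (wordSymbols q t) memory output
      closes          : δ memory nothing ≡ just (p₀ , closing)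
      three           : length closing ≡ 3
      result          : output ++ closing ≡ wordSymbols q′ padded ++ [ nothing ]

  -- The growth by two: three closing symbols, less the new end symbol.
  phase-length : ∀ {q t q′ t′} (φ : Phase q t q′ t′) →
                 length (wordSymbols q′ (Phase.padded φ)) ≡ 2 + length (wordSymbols q t)
  phase-length {q} {t} {q′} φ = suc-injective (begin
    suc (length (wordSymbols q′ padded))           ≡⟨ +-comm (length (wordSymbols q′ padded)) 1 ⟨
    length (wordSymbols q′ padded) + 1             ≡⟨ length-++ (wordSymbols q′ padded) ⟨
    length (wordSymbols q′ padded ++ [ nothing ])  ≡⟨ cong length result ⟨
    length (output ++ closing)                     ≡⟨ length-++ output ⟩
    length output + length closing                 ≡⟨ cong₂ _+_ (feeds-length feeds) three ⟩
    length (wordSymbols q t) + 3                   ≡⟨ +-comm (length (wordSymbols q t)) 3 ⟩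
    3 + length (wordSymbols q t)                   ∎)
    where
    open Phase φ
    open ≡-Reasoning

  -- The pass may break off midway, because the last configuration is decoded at the beginning of
  -- the pass.
  record HaltingPhase (q : Fin n) (t : Tape) : Set where
    field
      {memory}        : P
      {output}        : List Symbol
      {symbol}        : Symbol
      {before after}  : List Symbol
      split           : wordSymbols q t ≡ before ++ symbol ∷ after
      feeds           : Feeds p₀ before memory output
      stops           : δ memory symbol ≡ nothing

module Rewriting (M : TuringMachine) where

  open TuringMachine M
  open Trimming (suc m)

  -- The symbols of a configuration are rewritten from left to right with a delay
  -- of one: pending y is still to be written as y, entering q b as b, and in the
  -- latter case the head arrives in state q at the symbol read next.
  data Memory : Set where
    pending  : Letter State → Memory
    entering : State → Bool → Memory

  start-memory : Memory
  start-memory = pending (cell false)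

  turn : Letter State → Maybe (Bool × Direction × State) → Maybe (Memory × List (Maybe (Letter State)))
  turn y        (just (b , R , q)) = just (entering q b , [ just y ])
  turn (cell c) (just (b , L , q)) = just (pending (cell b) , [ just (head q c) ])
  -- Either the rule is undefined and `M` halts, or a left move meets a second head, which no
  -- configuration contains.
  turn _        _                  = nothing

  -- The symbol nothing ends a configuration.  Reading it supplies one more blank.
  δ : Memory → Maybe (Letter State) → Maybe (Memory × List (Maybe (Letter State)))
  δ (pending y)    (just (cell c))   = just (pending (cell c) , [ just y ])
  δ (pending y)    (just (head q b)) = turn y (f q b)
  δ (pending y)    nothing           =
    just (start-memory , just y ∷ just (cell false) ∷ nothing ∷ [])
  δ (entering q b) (just (cell c))   = just (pending (head q c) , [ just (cell b) ])
  δ (entering q b) (just (head _ _)) = nothing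
  δ (entering q b) nothing           =
    just (start-memory , just (cell b) ∷ just (head q false) ∷ nothing ∷ [])

  -- `start-memory` is omitted because it is put in front: this completes `alphabet`, and its
  -- membership proof computes to `here refl`.
  memories : List Memory
  memories = map pending nonblanks ++ cartesianProductWith entering (allFin (suc m)) (false ∷ true ∷ [])

  memory-∈ : ∀ p → p ∈ˡ start-memory ∷ memories
  memory-∈ (pending y)        = ∈-++⁺ˡ (∈-map⁺ pending (∈-alphabet y))
  memory-∈ (entering q false) = ∈-++⁺ʳ (map pending alphabet)
    (∈-cartesianProductWith⁺ entering (∈-allFin q) (here refl))
  memory-∈ (entering q true)  = ∈-++⁺ʳ (map pending alphabet)
    (∈-cartesianProductWith⁺ entering (∈-allFin q) (there (here refl)))

  open Phases δ start-memory

  -- What has been written of the left side when the head is read: the nearest cell is still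
  -- pending, and the initial pending blank has come out at the far end. If the left side is empty,
  -- that blank itself is pending.
  pad : List Bool → List Bool
  pad []      = []
  pad (_ ∷ l) = l ++ [ false ]

  trim-pad : ∀ l → trim (pad l) ≡ trim (beyond l)
  trim-pad []      = refl
  trim-pad (_ ∷ l) = trim-∷ʳ l

  reverse-pad : ∀ l → reverse (pad l) ++ [ nearest l ] ≡ reverse (l ++ [ false ])
  reverse-pad []      = refl
  reverse-pad (a ∷ l) = sym (unfold-reverse a (l ++ [ false ]))

  feed-cells : ∀ y bs c → Feeds (pending y) (cellSymbols (bs ++ [ c ])) (pending (cell c))
                                (just y ∷ cellSymbols bs)
  feed-cells y []       c = refl ∷ []
  feed-cells y (b ∷ bs) c = refl ∷ feed-cells (cell b) bs c

  feed-left : ∀ l → Feeds start-memory (cellSymbols (reverse l)) (pending (cell (nearest l)))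
                          (cellSymbols (reverse (pad l)))
  feed-left []      = []
  feed-left (a ∷ l) rewrite unfold-reverse a l | reverse-++ l [ false ] =
    feed-cells (cell false) (reverse l) a

  feed-right : ∀ y r → ∃[ y′ ] ∃[ vs ] (Feeds (pending y) (cellSymbols r) (pending y′) vs ×
                 vs ++ [ just y′ ] ≡ just y ∷ cellSymbols r)
  feed-right y []      = y , [] , [] , refl
  feed-right y (b ∷ r) =
    let y′ , vs , φ , eq = feed-right (cell b) r
    in y′ , just y ∷ vs , refl ∷ φ , cong (just y ∷_) eq

  feed-head : ∀ l {q b p vs} → δ (pending (cell (nearest l))) (just (head q b)) ≡ just (p , vs) →
    (single : ∃[ v ] vs ≡ [ v ]) → ∀ {r p′ ws} → Feeds p (cellSymbols r) p′ ws →
    Feeds start-memory (wordSymbols q (tape l b r)) p′ (cellSymbols (reverse (pad l)) ++ vs ++ ws)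
  feed-head l {q} {b} eq (v , refl) {r} {ws = ws} φ rewrite wordSymbols-≡ q l b r =
    feed-left l ⊕ (eq ∷ φ)

  closing-right : ∀ y r {y′ vs} (us : List Symbol) → vs ++ [ just y′ ] ≡ just y ∷ cellSymbols r →
    (us ++ vs) ++ just y′ ∷ just (cell false) ∷ nothing ∷ [] ≡
    us ++ just y ∷ cellSymbols (r ++ [ false ]) ++ [ nothing ]
  closing-right y r {y′} {vs} us eq = begin
    (us ++ vs) ++ just y′ ∷ rest              ≡⟨ ++-assoc us vs (just y′ ∷ rest) ⟩
    us ++ vs ++ just y′ ∷ rest                ≡⟨ cong (us ++_) (++-assoc vs [ just y′ ] rest) ⟨
    us ++ (vs ++ [ just y′ ]) ++ rest         ≡⟨ cong (λ u → us ++ u ++ rest) eq ⟩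
    us ++ just y ∷ cellSymbols r ++ rest      ≡⟨ cong (λ u → us ++ just y ∷ u) (++-assoc (cellSymbols r) [ just (cell false) ] [ nothing ]) ⟨
    us ++ just y ∷ (cellSymbols r ++ [ just (cell false) ]) ++ [ nothing ]
                                              ≡⟨ cong (λ u → us ++ just y ∷ u ++ [ nothing ]) (cellSymbols-++ r [ false ]) ⟨
    us ++ just y ∷ cellSymbols (r ++ [ false ]) ++ [ nothing ] ∎
    where
    open ≡-Reasoning
    rest : List Symbol
    rest = just (cell false) ∷ nothing ∷ []

  passed : ∀ l b → (cellSymbols (reverse (pad l)) ++ [ just (cell (nearest l)) ]) ++ [ just (cell b) ] ≡
                   cellSymbols (reverse (b ∷ l ++ [ false ]))
  passed l b = begin
    (cellSymbols (reverse (pad l)) ++ [ just (cell (nearest l)) ]) ++ [ just (cell b) ]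
      ≡⟨ cong (_++ [ just (cell b) ]) (cellSymbols-++ (reverse (pad l)) [ nearest l ]) ⟨
    cellSymbols (reverse (pad l) ++ [ nearest l ]) ++ [ just (cell b) ]
      ≡⟨ cong (λ u → cellSymbols u ++ [ just (cell b) ]) (reverse-pad l) ⟩
    cellSymbols (reverse (l ++ [ false ])) ++ [ just (cell b) ]
      ≡⟨ cellSymbols-++ (reverse (l ++ [ false ])) [ b ] ⟨
    cellSymbols (reverse (l ++ [ false ]) ++ [ b ])
      ≡⟨ cong cellSymbols (unfold-reverse b (l ++ [ false ])) ⟨
    cellSymbols (reverse (b ∷ l ++ [ false ])) ∎
    where open ≡-Reasoning

  phase : ∀ q t {b d q′} → f q (scanned t) ≡ just (b , d , q′) → Phase q t q′ (move d (write b t))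
  phase q (tape l a r) {b} {L} {q′} eq
    with y , vs , φ , vs≡ ← feed-right (cell b) r = record
    { padded  = tape (pad l) (nearest l) (b ∷ r ++ [ false ])
    ; padded≈ = subst (tape (pad l) (nearest l) (b ∷ r ++ [ false ]) ≈_) (sym (move-L l b r))
                  (same (trim-pad l) refl (cong (cons b) (trim-∷ʳ r)))
    ; feeds   = feed-head l (cong (turn (cell (nearest l))) eq) (_ , refl) φ
    ; closes  = refl
    ; three   = refl
    ; result  = begin
        (us ++ h ∷ vs) ++ just y ∷ rest                  ≡⟨ cong (_++ (just y ∷ rest)) (++-assoc us [ h ] vs) ⟨
        ((us ++ [ h ]) ++ vs) ++ just y ∷ rest           ≡⟨ closing-right (cell b) r (us ++ [ h ]) vs≡ ⟩
        (us ++ [ h ]) ++ cellSymbols (b ∷ r ++ [ false ]) ++ [ nothing ]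
                                                         ≡⟨ ++-assoc (us ++ [ h ]) (cellSymbols (b ∷ r ++ [ false ])) [ nothing ] ⟨
        ((us ++ [ h ]) ++ cellSymbols (b ∷ r ++ [ false ])) ++ [ nothing ]
                                                         ≡⟨ cong (_++ [ nothing ]) (++-assoc us [ h ] _) ⟩
        (us ++ h ∷ cellSymbols (b ∷ r ++ [ false ])) ++ [ nothing ]
                                                         ≡⟨ cong (_++ [ nothing ]) (wordSymbols-≡ q′ (pad l) (nearest l) (b ∷ r ++ [ false ])) ⟨
        wordSymbols q′ (tape (pad l) (nearest l) (b ∷ r ++ [ false ])) ++ [ nothing ] ∎
    }
    where
    open ≡-Reasoning
    us rest : List Symbol
    us   = cellSymbols (reverse (pad l))
    rest = just (cell false) ∷ nothing ∷ []
    h : Symbol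
    h = just (head q′ (nearest l))
  -- The word ends before the head has found a cell to enter, so the blank supplied by the closing
  -- becomes the scanned cell.
  phase q (tape l a []) {b} {R} {q′} eq = record
    { padded  = tape (b ∷ l ++ [ false ]) false []
    ; padded≈ = same (cong (cons b) (trim-∷ʳ l)) refl refl
    ; feeds   = feed-head l (cong (turn (cell (nearest l))) eq) (_ , refl) []
    ; closes  = refl
    ; three   = refl
    ; result  = begin
        (us ++ [ n ]) ++ just (cell b) ∷ just (head q′ false) ∷ nothing ∷ []
                                                     ≡⟨ ++-assoc (us ++ [ n ]) [ just (cell b) ] _ ⟨
        ((us ++ [ n ]) ++ [ just (cell b) ]) ++ just (head q′ false) ∷ nothing ∷ []
                                                     ≡⟨ cong (_++ (just (head q′ false) ∷ nothing ∷ [])) (passed l b) ⟩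
        cellSymbols (reverse (b ∷ l ++ [ false ])) ++ just (head q′ false) ∷ nothing ∷ []
                                                     ≡⟨ ++-assoc (cellSymbols (reverse (b ∷ l ++ [ false ]))) [ just (head q′ false) ] [ nothing ] ⟨
        (cellSymbols (reverse (b ∷ l ++ [ false ])) ++ [ just (head q′ false) ]) ++ [ nothing ]
                                                     ≡⟨ cong (_++ [ nothing ]) (wordSymbols-≡ q′ (b ∷ l ++ [ false ]) false []) ⟨
        wordSymbols q′ (tape (b ∷ l ++ [ false ]) false []) ++ [ nothing ] ∎
    }
    where
    open ≡-Reasoning
    us : List Symbol
    us = cellSymbols (reverse (pad l))
    n : Symbol
    n = just (cell (nearest l))
  phase q (tape l a (c ∷ r)) {b} {R} {q′} eq
    with y , vs , φ , vs≡ ← feed-right (head q′ c) r = record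
    { padded  = tape (b ∷ l ++ [ false ]) c (r ++ [ false ])
    ; padded≈ = same (cong (cons b) (trim-∷ʳ l)) refl (trim-∷ʳ r)
    ; feeds   = feed-head l (cong (turn (cell (nearest l))) eq) (_ , refl) {c ∷ r} (refl ∷ φ)
    ; closes  = refl
    ; three   = refl
    ; result  = begin
        (us ++ n ∷ just (cell b) ∷ vs) ++ just y ∷ rest
          ≡⟨ cong (_++ (just y ∷ rest)) (trans (sym (++-assoc us [ n ] (just (cell b) ∷ vs)))
               (sym (++-assoc (us ++ [ n ]) [ just (cell b) ] vs))) ⟩
        (((us ++ [ n ]) ++ [ just (cell b) ]) ++ vs) ++ just y ∷ rest
          ≡⟨ cong (λ u → (u ++ vs) ++ just y ∷ rest) (passed l b) ⟩
        (ps ++ vs) ++ just y ∷ rest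
          ≡⟨ closing-right (head q′ c) r ps vs≡ ⟩
        ps ++ just (head q′ c) ∷ cellSymbols (r ++ [ false ]) ++ [ nothing ]
          ≡⟨ ++-assoc ps (just (head q′ c) ∷ cellSymbols (r ++ [ false ])) [ nothing ] ⟨
        (ps ++ just (head q′ c) ∷ cellSymbols (r ++ [ false ])) ++ [ nothing ]
          ≡⟨ cong (_++ [ nothing ]) (wordSymbols-≡ q′ (b ∷ l ++ [ false ]) c (r ++ [ false ])) ⟨
        wordSymbols q′ (tape (b ∷ l ++ [ false ]) c (r ++ [ false ])) ++ [ nothing ] ∎
    }
    where
    open ≡-Reasoning
    us ps rest : List Symbol
    us   = cellSymbols (reverse (pad l))
    ps   = cellSymbols (reverse (b ∷ l ++ [ false ]))
    rest = just (cell false) ∷ nothing ∷ []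
    n : Symbol
    n = just (cell (nearest l))

  halting-phase : ∀ q t → f q (scanned t) ≡ nothing → HaltingPhase q t
  halting-phase q (tape l b r) eq = record
    { split = wordSymbols-≡ q l b r
    ; feeds = feed-left l
    ; stops = cong (turn (cell (nearest l))) eq
    }

-- The simulation and its cost

module PhaseSimulation
  {n : ℕ} (q₀ : Fin n) (next : Config n → Maybe (Config n))
  {P : Set} (δ : P → Maybe (Letter (Fin n)) → Maybe (P × List (Maybe (Letter (Fin n)))))
  (p₀ : P) (memories : List P) (memory-∈ : ∀ p → p ∈ˡ p₀ ∷ memories)
  (first : memory-∈ p₀ ≡ here refl)
  (symbols : List (Maybe (Letter (Fin n)))) (symbol-∈ : ∀ x → x ∈ˡ symbols)
  (phases : ∀ {q t q′ t′} u → u ≈ t → next (config q t) ≡ just (config q′ t′) →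
            Phases.Phase δ p₀ q u q′ t′)
  (halting-phases : ∀ {q t} u → u ≈ t → next (config q t) ≡ nothing →
                    Phases.HaltingPhase δ p₀ q u)
  (cells-next : ∀ {c c′} → next c ≡ just c′ → cells (content c) ≤ cells (content c′))
  where

  open Trimming n using (fullWord; alphabet; ∈-alphabet; trimmer; trimmer-functional; trimmer-word)
  open Phases δ p₀
  open Queue δ p₀ memories memory-∈ first symbols symbol-∈
  open WangB wangB using (stepW)

  A : Machine
  A = record { controls = n ; start = q₀ ; step = next }

  W : Machine
  W = WangB.machine wangB

  startControl : Fin (suc (suc (N * 5)))
  startControl = inject₁ (position (start (pop p₀)))

  startControl≡zero : startControl ≡ zero
  startControl≡zero = trans (cong (inject₁ ∘ position) start-first) position-zero

  queueStart : List Bool → Symbol → List Symbol → Config (suc (suc (N * 5)))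
  queueStart g z xs = config startControl (tapeAt (true ∷ g) (queueTail z (xs ++ [ nothing ])))

  -- The garbage is unconstrained because no later cycle enters it: `back` stops at the latest flag
  -- that was set.
  record Represents (ℓ : ℕ) (c : Config n) (d : Config (suc (suc (N * 5)))) : Set where
    constructor represents
    field
      garbage    : List Bool
      lastPopped : Symbol
      padded     : Tape
      padded≈    : padded ≈ content c
      length≡    : length (wordSymbols (control c) padded) ≡ ℓ
      config≡    : d ≡ queueStart garbage lastPopped (wordSymbols (control c) padded)

  -- The end symbol brings the number of pops to `suc ℓ`; the factor 5 counts the instructions of an
  -- operation.
  phaseCost : ℕ → ℕ
  phaseCost ℓ = suc ℓ * popCost (suc ℓ) * 5

  phaseCost-mono : ∀ {a b} → a ≤ b → phaseCost a ≤ phaseCost b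
  phaseCost-mono a≤b = *-monoˡ-≤ 5 (*-mono-≤ (s≤s a≤b) (popCost-mono (s≤s a≤b)))

  length-end : ∀ (xs : List Symbol) → length (xs ++ [ nothing ]) ≡ suc (length xs)
  length-end xs = trans (length-++ xs) (+-comm (length xs) 1)

  phase-path : ∀ {xs p vs ws} → Feeds p₀ xs p vs → δ p nothing ≡ just (p₀ , ws) → length ws ≡ 3 →
    ∀ g z → ∃[ g′ ]
    entry (pop p₀) ∣ true ∷ g ∣ queueTail z (xs ++ [ nothing ])
      ⟶⁺[ suc (length xs) * popCost (suc (length xs)) ]
    entry (pop p₀) ∣ true ∷ g′ ∣ queueTail nothing (vs ++ ws)
  phase-path {xs} {vs = vs} φ closes three g z with z′ , g′ , π ← feed φ [ nothing ] z {g} =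
    _ , within⁺ count (π ▸⁺ pop-push closes (≤-reflexive three) z′ vs)
    where
    ℓ : ℕ
    ℓ = length xs
    count : ℓ * popCost (length (xs ++ [ nothing ])) + popCost (length vs) ≤
            popCost (suc ℓ) + ℓ * popCost (suc ℓ)
    count = ≤-trans
      (+-mono-≤ {y = ℓ * popCost (suc ℓ)} {v = popCost (suc ℓ)}
        (≤-reflexive (cong (λ i → ℓ * popCost i) (length-end xs)))
        (popCost-mono (≤-trans (≤-reflexive (feeds-length φ)) (n≤1+n ℓ))))
      (≤-reflexive (+-comm (ℓ * popCost (suc ℓ)) (popCost (suc ℓ))))

  -- The strict inequality leaves room for the final instruction, for which `stop` charges one more
  -- operation.
  2unit<popCost : ∀ n → unit + unit < popCost n
  2unit<popCost n = subst (unit + unit <_) (sym (popCost-≡ n))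
    (≤-trans (+-monoˡ-≤ (unit + unit) (s≤s (z≤n {suc s})))
      (≤-trans (m≤m+n (unit + (unit + unit)) (14 * unit + 2 * n * unit))
        (≤-reflexive (total n unit))))
    where
    total : ∀ n u → u + (u + u) + (14 * u + 2 * n * u) ≡ (17 + 2 * n) * u
    total = solve-∀

  halt-path : ∀ {xs p vs x ys} → Feeds p₀ xs p vs → δ p x ≡ nothing → ∀ g z →
    let ℓ = length (xs ++ x ∷ ys) in
    ∃[ n ] ∃[ l ] ∃[ r ]
    (entry (pop p₀) ∣ true ∷ g ∣ queueTail z ((xs ++ x ∷ ys) ++ [ nothing ])
      ⟶⁺[ n ] halted ∣ l ∣ r) × n < suc ℓ * popCost (suc ℓ)
  halt-path {xs} {p} {vs} {x} {ys} φ stops g z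
    with z′ , g′ , π ← feed φ (x ∷ ys ++ [ nothing ]) z {g}
    with l , r , σ ← pop-halts p x z′ {g′} {blocks ((ys ++ [ nothing ]) ++ vs) ++ freeBlock} stops =
    _ , l , r ,
    subst (λ u → entry (pop p₀) ∣ true ∷ g ∣ queueTail z u
                   ⟶⁺[ length xs * popCost (length (xs ++ x ∷ ys ++ [ nothing ])) + (unit + unit) ]
                   halted ∣ l ∣ r)
      (sym (++-assoc xs (x ∷ ys) [ nothing ]))
      (π ▸⁺ recast refl (cong ((onehot z′ ++ [ true ]) ++_)
                            (sym (++-assoc (block false x) (blocks ((ys ++ [ nothing ]) ++ vs)) freeBlock)))
              refl refl σ) ,
    count
    where
    ℓ : ℕ
    ℓ = length (xs ++ x ∷ ys)
    total≡ : length (xs ++ x ∷ ys ++ [ nothing ]) ≡ suc ℓ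
    total≡ = trans (cong length (sym (++-assoc xs (x ∷ ys) [ nothing ]))) (length-end (xs ++ x ∷ ys))
    xs≤ : length xs ≤ ℓ
    xs≤ = ≤-trans (m≤m+n (length xs) (suc (length ys))) (≤-reflexive (sym (length-++ xs)))
    count : suc (length xs * popCost (length (xs ++ x ∷ ys ++ [ nothing ])) + (unit + unit)) ≤
            popCost (suc ℓ) + ℓ * popCost (suc ℓ)
    count = ≤-trans (≤-reflexive (sym (+-suc _ (unit + unit))))
      (≤-trans (+-mono-≤ {y = ℓ * popCost (suc ℓ)} {v = popCost (suc ℓ)}
          (≤-trans (≤-reflexive (cong (λ n → length xs * popCost n) total≡)) (*-monoˡ-≤ (popCost (suc ℓ)) xs≤))
          (2unit<popCost (suc ℓ)))
        (≤-reflexive (+-comm (ℓ * popCost (suc ℓ)) (popCost (suc ℓ)))))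

  restart : ∀ {n t t′} → Reach⁺ n (entry (pop p₀) , t) (entry (pop p₀) , t′) →
    ∃[ k ] (run stepW (suc k) (config startControl t) ≡ just (config startControl t′) × suc k ≤ n * 5)
  restart ρ = let k , _ , loc , r , k≤ = reach⁺-run ρ refl in
    k , trans r (cong (λ c → just (wconfig c _)) loc) , k≤

  advances : ∀ {ℓ c c′ d} → Represents ℓ c d → next c ≡ just c′ →
    ∃[ k ] ∃[ d′ ] (run stepW (suc k) d ≡ just d′ × suc k ≤ phaseCost ℓ × Represents (2 + ℓ) c′ d′)
  advances {ℓ} {config q t} {config q′ t′} {d} (represents g z u u≈ ℓ≡ d≡) eq =
    proj₁ restarted , queueStart g′ nothing (wordSymbols q′ φ.padded) ,
    subst₂ (λ d d′ → run stepW (suc (proj₁ restarted)) d ≡ just d′) (sym d≡)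
      (cong (λ xs → config startControl (tapeAt (true ∷ g′) (queueTail nothing xs))) φ.result)
      (proj₁ (proj₂ restarted)) ,
    subst (λ ℓ → suc (proj₁ restarted) ≤ phaseCost ℓ) ℓ≡ (proj₂ (proj₂ restarted)) ,
    represents g′ nothing φ.padded φ.padded≈ (trans (phase-length φ) (cong (2 +_) ℓ≡)) refl
    where
    φ : Phase q u q′ t′
    φ = phases u u≈ eq
    module φ = Phase φ
    arrival = phase-path φ.feeds φ.closes φ.three g z
    g′ : List Bool
    g′ = proj₁ arrival
    restarted = restart (_∣_∣_⟶⁺[_]_∣_∣_.reach (proj₂ arrival))

  stop : ∀ {n t t′} → Reach⁺ n (entry (pop p₀) , t) (halted , t′) →
    ∃[ k ] ∃[ d ] (EndsAt stepW (config startControl t) k d × k ≤ suc n * 5)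
  stop {n} {t} {t′} ρ =
    let k , k′ , loc , r , k≤ = reach⁺-run ρ refl
        d , e = halted-ends t′
    in suc k + 1 , d ,
       EndsAt-+ {f = stepW} (suc k) {1} {config startControl t} {wconfig (fromℕ N) t′}
         (trans r (cong (λ c → just (wconfig c t′)) loc)) e ,
       ≤-trans (+-mono-≤ k≤ (s≤s (z≤n {4}))) (≤-reflexive (+-comm (n * 5) 5))

  halts : ∀ {ℓ c d} → Represents ℓ c d → next c ≡ nothing →
    ∃[ k ] ∃[ d′ ] (EndsAt stepW d k d′ × k ≤ phaseCost ℓ)
  halts {ℓ} {config q t} {d} (represents g z u u≈ ℓ≡ d≡) eq =
    k , d′ ,
    subst (λ d → EndsAt stepW d k d′)
      (sym (trans d≡ (cong (λ xs → queueStart g z xs) φ.split)))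
      (proj₁ (proj₂ (proj₂ stopped))) ,
    ≤-trans (proj₂ (proj₂ (proj₂ stopped)))
      (≤-trans (*-monoˡ-≤ 5 (proj₂ (proj₂ (proj₂ (proj₂ halting)))))
        (≤-reflexive (cong phaseCost (trans (cong length (sym φ.split)) ℓ≡))))
    where
    φ : HaltingPhase q u
    φ = halting-phases u u≈ eq
    module φ = HaltingPhase φ
    halting = halt-path φ.feeds φ.stops g z
    stopped = stop (_∣_∣_⟶⁺[_]_∣_∣_.reach (proj₁ (proj₂ (proj₂ (proj₂ halting)))))
    k : ℕ
    k = proj₁ stopped
    d′ : Config (suc (suc (N * 5)))
    d′ = proj₁ (proj₂ stopped)

  module Lift = Lifting next stepW Represents phaseCost phaseCost-mono advances halts

  -- Encoding and decoding of queues

  InLetter OutLetter : Set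
  InLetter  = Letter (Fin n)
  OutLetter = Letter (Fin (suc (suc (N * 5))))

  codeword : Symbol → List OutLetter
  codeword x = map cell (block false x)

  marker : Symbol → List OutLetter
  marker z = head zero true ∷ map cell (onehot z ++ [ true ])

  encoded : List InLetter → List OutLetter
  encoded []       = codeword nothing ++ []
  encoded (x ∷ xs) = codeword (just x) ++ encoded xs

  encoded-blocks : ∀ xs → map cell (blocks (map just xs ++ [ nothing ])) ≡ encoded xs
  encoded-blocks []       = map-++ cell (block false nothing) []
  encoded-blocks (x ∷ xs) =
    trans (map-++ cell (block false (just x)) (blocks (map just xs ++ [ nothing ])))
          (cong (codeword (just x) ++_) (encoded-blocks xs))

  module Enc = WordTransducers InLetter OutLetter
  module Dec = WordTransducers OutLetter InLetter

  encoding : Enc.WordTransducer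
  encoding = record
    { states    = 3
    ; initial   = 0F
    ; final     = 2F
    ; wordEdges = (0F , [] , marker nothing , 1F) ∷ (1F , [] , codeword nothing , 2F) ∷
                  map (λ x → 1F , [ x ] , codeword (just x) , 1F) alphabet
    }

  -- State `0F` skips the garbage, which consists of plain cells, until the head letter shows where
  -- the last popped block begins. That block is dropped, and the codeword of `nothing` ends the
  -- configuration.
  decoding : Dec.WordTransducer
  decoding = record
    { states    = 3
    ; initial   = 0F
    ; final     = 2F
    ; wordEdges = (0F , [ cell false ] , [] , 0F) ∷ (0F , [ cell true ] , [] , 0F) ∷
                  (1F , codeword nothing , [] , 2F) ∷
                  map (λ z → 0F , marker z , [] , 1F) symbols ++
                  map (λ x → 1F , codeword (just x) , [ x ] , 1F) alphabet
    }

  private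
    module Encoding = Enc.WordTransducer encoding
    module Decoding = Dec.WordTransducer decoding

  encoding₂-sound : ∀ {u v} → Enc.WordPath Encoding.Edge 2F u v 2F → u ≡ [] × v ≡ []
  encoding₂-sound Enc.done = refl , refl
  encoding₂-sound (Enc.step (there (there e)) π) with () ← proj₂ (proj₂ (∈-map⁻ _ e))

  encoding₁-sound : ∀ {u v} → Enc.WordPath Encoding.Edge 1F u v 2F → v ≡ encoded u
  encoding₁-sound (Enc.step (there (here refl)) π) with refl , refl ← encoding₂-sound π = refl
  encoding₁-sound (Enc.step (there (there e)) π) with x , _ , refl ← ∈-map⁻ _ e =
    cong (codeword (just x) ++_) (encoding₁-sound π)

  encoding-sound : ∀ {u v} → Encoding.Accepts u v → v ≡ marker nothing ++ encoded u
  encoding-sound (Enc.step (here refl) π) = cong (marker nothing ++_) (encoding₁-sound π)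
  encoding-sound (Enc.step (there (there e)) π) with () ← proj₂ (proj₂ (∈-map⁻ _ e))

  encoding₁-complete : ∀ u → Enc.WordPath Encoding.Edge 1F u (encoded u) 2F
  encoding₁-complete []      = Enc.step (there (here refl)) Enc.done
  encoding₁-complete (x ∷ u) =
    Enc.step (there (there (∈-map⁺ _ (∈-alphabet x)))) (encoding₁-complete u)

  encoding-complete : ∀ u → Encoding.Accepts u (marker nothing ++ encoded u)
  encoding-complete u = Enc.step (here refl) (encoding₁-complete u)

  private
    marker-edges : List (Dec.WordEdge 3)
    marker-edges = map (λ z → 0F , marker z , [] , 1F) symbols

  decoding₂-sound : ∀ {u v} → Dec.WordPath Decoding.Edge 2F u v 2F → u ≡ [] × v ≡ []
  decoding₂-sound Dec.done = refl , refl
  decoding₂-sound (Dec.step (there (there (there e))) π) with ∈-++⁻ marker-edges e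
  ... | inj₁ e′ with () ← proj₂ (proj₂ (∈-map⁻ _ e′))
  ... | inj₂ e′ with () ← proj₂ (proj₂ (∈-map⁻ _ e′))

  decoding₁-sound : ∀ {u v} → Dec.WordPath Decoding.Edge 1F u v 2F → u ≡ encoded v
  decoding₁-sound (Dec.step (there (there (here refl))) π) with refl , refl ← decoding₂-sound π = refl
  decoding₁-sound (Dec.step (there (there (there e))) π) with ∈-++⁻ marker-edges e
  decoding₁-sound (Dec.step (there (there (there e))) π) | inj₁ e′ with () ← proj₂ (proj₂ (∈-map⁻ _ e′))
  decoding₁-sound (Dec.step (there (there (there e))) π) | inj₂ e′ with x , _ , refl ← ∈-map⁻ _ e′ =
    cong (codeword (just x) ++_) (decoding₁-sound π)

  -- A formula for the input in terms of the output, so that functionality becomes unique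
  -- decodability.
  decoding-sound : ∀ {u v} → Decoding.Accepts u v →
                   ∃[ g ] ∃[ z ] u ≡ map cell g ++ marker z ++ encoded v
  decoding-sound (Dec.step (here refl) π) =
    let g , z , eq = decoding-sound π in false ∷ g , z , cong (cell false ∷_) eq
  decoding-sound (Dec.step (there (here refl)) π) =
    let g , z , eq = decoding-sound π in true ∷ g , z , cong (cell true ∷_) eq
  decoding-sound (Dec.step (there (there (there e))) π) with ∈-++⁻ marker-edges e
  decoding-sound (Dec.step (there (there (there e))) π) | inj₁ e′ with z , _ , refl ← ∈-map⁻ _ e′ =
    [] , z , cong (marker z ++_) (decoding₁-sound π)
  decoding-sound (Dec.step (there (there (there e))) π) | inj₂ e′ with () ← proj₂ (proj₂ (∈-map⁻ _ e′))

  decoding₁-complete : ∀ v → Dec.WordPath Decoding.Edge 1F (encoded v) v 2F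
  decoding₁-complete []      = Dec.step (there (there (here refl))) Dec.done
  decoding₁-complete (x ∷ v) =
    Dec.step (there (there (there (∈-++⁺ʳ marker-edges (∈-map⁺ _ (∈-alphabet x)))))) (decoding₁-complete v)

  decoding-complete : ∀ g z v → Decoding.Accepts (map cell g ++ marker z ++ encoded v) v
  decoding-complete []          z v =
    Dec.step (there (there (there (∈-++⁺ˡ (∈-map⁺ _ (symbol-∈ z)))))) (decoding₁-complete v)
  decoding-complete (false ∷ g) z v = Dec.step (here refl) (decoding-complete g z v)
  decoding-complete (true ∷ g)  z v = Dec.step (there (here refl)) (decoding-complete g z v)

  ++-cancel-length : {B : Set} (as bs : List B) {cs ds : List B} → length as ≡ length bs →
              as ++ cs ≡ bs ++ ds → as ≡ bs × cs ≡ ds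
  ++-cancel-length []       []       _   eq = refl , eq
  ++-cancel-length (a ∷ as) (b ∷ bs) len eq =
    let eq₁ , eq₂ = ∷-injective eq
        eq₃ , eq₄ = ++-cancel-length as bs (suc-injective len) eq₂
    in cong₂ _∷_ eq₁ eq₃ , eq₄

  cell-injective : ∀ {Q : Set} {a b} → cell {Q} a ≡ cell b → a ≡ b
  cell-injective refl = refl

  blanks-injective : {B : Set} (as bs : List B) {x y : B} {cs ds : List B} {us vs : List Bool} →
    as ++ x ∷ cs ≡ bs ++ y ∷ ds →
    blanks (length as) ++ true ∷ us ≡ blanks (length bs) ++ true ∷ vs → x ≡ y
  blanks-injective []       []       eq _   = ∷-injectiveˡ eq
  blanks-injective (_ ∷ as) (_ ∷ bs) eq eq′ =
    blanks-injective as bs (∷-injectiveʳ eq) (∷-injectiveʳ eq′)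
  blanks-injective []       (_ ∷ _)  eq ()
  blanks-injective (_ ∷ _)  []       eq ()

  onehot-injective : ∀ x y → onehot x ≡ onehot y → x ≡ y
  onehot-injective x y =
    blanks-injective (before x) (before y) (trans (sym (symbols-split x)) (symbols-split y))

  length-codeword : ∀ x → length (codeword x) ≡ unit
  length-codeword x = trans (length-map cell (block false x)) (sym (cong suc (length-tail x)))

  codeword-cancel : ∀ x y {us vs} → codeword x ++ us ≡ codeword y ++ vs → x ≡ y × us ≡ vs
  codeword-cancel x y eq
    with eq₁ , eq₂ ← ++-cancel-length (codeword x) (codeword y)
                       (trans (length-codeword x) (sym (length-codeword y))) eq =
    onehot-injective x y (++-cancelʳ [ true ] (onehot x) (onehot y)
      (∷-injectiveʳ (map-injective cell-injective eq₁))) , eq₂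

  encoded-injective : ∀ u v → encoded u ≡ encoded v → u ≡ v
  encoded-injective []      []      eq = refl
  encoded-injective []      (y ∷ v) eq with () ← proj₁ (codeword-cancel nothing (just y) eq)
  encoded-injective (x ∷ u) []      eq with () ← proj₁ (codeword-cancel (just x) nothing eq)
  encoded-injective (x ∷ u) (y ∷ v) eq with refl , eq′ ← codeword-cancel (just x) (just y) eq =
    cong (x ∷_) (encoded-injective u v eq′)

  length-marker : ∀ z → length (marker z) ≡ unit
  length-marker z = cong suc (trans (length-map cell (onehot z ++ [ true ])) (sym (length-tail z)))

  -- The first head letter shows where the plain cells end, and all markers have the same length.
  marker-cancel : ∀ g g′ z z′ {us vs} →
    map cell g ++ marker z ++ us ≡ map cell g′ ++ marker z′ ++ vs → us ≡ vs
  marker-cancel []      []       z z′ eq =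
    proj₂ (++-cancel-length (marker z) (marker z′) (trans (length-marker z) (sym (length-marker z′))) eq)
  marker-cancel (_ ∷ g) (_ ∷ g′) z z′ eq = marker-cancel g g′ z z′ (∷-injectiveʳ eq)
  marker-cancel []      (_ ∷ _)  z z′ ()
  marker-cancel (_ ∷ _) []       z z′ ()

  encoder : Transducer InLetter OutLetter
  encoder = Enc.toTransducer encoding

  encoder-functional : Transducer.Functional encoder
  encoder-functional a b = trans (encoding-sound (Enc.transduces⁻ encoding a))
                                 (sym (encoding-sound (Enc.transduces⁻ encoding b)))

  blockDecoder : Transducer OutLetter InLetter
  blockDecoder = Dec.toTransducer decoding

  blockDecoder-functional : Transducer.Functional blockDecoder
  blockDecoder-functional {v = v} {v′} a b =
    let g , z , eq    = decoding-sound (Dec.transduces⁻ decoding a)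
        g′ , z′ , eq′ = decoding-sound (Dec.transduces⁻ decoding b)
    in encoded-injective v v′ (marker-cancel g g′ z z′ (trans (sym eq) eq′))

  module Decoder = Composition letter-≟ blockDecoder trimmer

  trim-ending : ∀ bs k → trim (bs ++ true ∷ blanks k) ≡ bs ++ [ true ]
  trim-ending []           k = cong (true ∷_) (trim-blanks k)
    where
    trim-blanks : ∀ k → trim (blanks k) ≡ []
    trim-blanks zero    = refl
    trim-blanks (suc k) rewrite trim-blanks k = refl
  trim-ending (true ∷ bs)  k = cong (true ∷_) (trim-ending bs k)
  trim-ending (false ∷ bs) k rewrite trim-ending bs k with bs
  ... | []    = refl
  ... | _ ∷ _ = refl

  -- The last block ends in 1, so trimming removes exactly the free block.
  trim-queueTail : ∀ z xs → trim (queueTail z (xs ++ [ nothing ])) ≡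
                   (onehot z ++ [ true ]) ++ blocks (xs ++ [ nothing ])
  trim-queueTail z xs = begin
    trim (os ++ blocks (xs ++ [ nothing ]) ++ freeBlock)
      ≡⟨ cong trim (++-assoc os (blocks (xs ++ [ nothing ])) freeBlock) ⟨
    trim ((os ++ blocks (xs ++ [ nothing ])) ++ freeBlock)
      ≡⟨ cong (λ u → trim (u ++ freeBlock)) ends ⟩
    trim ((front ++ [ true ]) ++ freeBlock)
      ≡⟨ cong trim (++-assoc front [ true ] freeBlock) ⟩
    trim (front ++ true ∷ freeBlock)
      ≡⟨ trim-ending front (2 + s) ⟩
    front ++ [ true ]
      ≡⟨ ends ⟨
    os ++ blocks (xs ++ [ nothing ]) ∎
    where
    open ≡-Reasoning
    os front : List Bool
    os    = onehot z ++ [ true ]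
    front = os ++ blocks xs ++ false ∷ onehot nothing
    ends : os ++ blocks (xs ++ [ nothing ]) ≡ front ++ [ true ]
    ends = begin
      os ++ blocks (xs ++ [ nothing ])
        ≡⟨ cong (os ++_) (concatMap-++ (block false) xs [ nothing ]) ⟩
      os ++ blocks xs ++ block false nothing ++ []
        ≡⟨ cong (λ u → os ++ blocks xs ++ u) (++-identityʳ (block false nothing)) ⟩
      os ++ blocks xs ++ (false ∷ onehot nothing) ++ [ true ]
        ≡⟨ cong (os ++_) (++-assoc (blocks xs) (false ∷ onehot nothing) [ true ]) ⟨
      os ++ (blocks xs ++ false ∷ onehot nothing) ++ [ true ]
        ≡⟨ ++-assoc os (blocks xs ++ false ∷ onehot nothing) [ true ] ⟨
      front ++ [ true ] ∎

  configWord-start : ∀ {k} g z xs → k ≡ zero →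
    configWord (config k (tapeAt (true ∷ g) (queueTail z (map just xs ++ [ nothing ])))) ≡
    map cell (reverse (trim g)) ++ marker z ++ encoded xs
  configWord-start g z xs refl = cong (λ u → map cell (reverse (trim g)) ++ head zero true ∷ u) (begin
    map cell (trim (queueTail z (map just xs ++ [ nothing ])))
      ≡⟨ cong (map cell) (trim-queueTail z (map just xs)) ⟩
    map cell ((onehot z ++ [ true ]) ++ blocks (map just xs ++ [ nothing ]))
      ≡⟨ map-++ cell (onehot z ++ [ true ]) (blocks (map just xs ++ [ nothing ])) ⟩
    map cell (onehot z ++ [ true ]) ++ map cell (blocks (map just xs ++ [ nothing ]))
      ≡⟨ cong (map cell (onehot z ++ [ true ]) ++_) (encoded-blocks xs) ⟩
    map cell (onehot z ++ [ true ]) ++ encoded xs ∎)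
    where open ≡-Reasoning

  decodes : ∀ {ℓ c d} → Represents ℓ c d → Transducer.Transduces Decoder.compose (configWord d) (configWord c)
  decodes {c = config q t} (represents g z u u≈ ℓ≡ d≡) = Decoder.compose⁺
    (subst (λ w → Transducer.Transduces blockDecoder w (fullWord q u))
      (sym (trans (cong configWord d≡) (configWord-start g z (fullWord q u) startControl≡zero)))
      (Dec.transduces⁺ decoding (decoding-complete (reverse (trim g)) z (fullWord q u))))
    (subst (Transducer.Transduces trimmer (fullWord q u)) (tapeWord-≈ q u≈) (trimmer-word q u))

  trimmed : Tape → Tape
  trimmed (tape l b r) = tape (trim l) b (trim r)

  trimmed-≈ : ∀ t → trimmed t ≈ t
  trimmed-≈ (tape l b r) = same (trim-idem l) refl (trim-idem r)

  -- A dummy popped block precedes the queue, since `pop` starts on the flag of such a block. The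
  -- tape is trimmed because the encoder sees only the trimmed word.
  initialTape : Tape → Tape
  initialTape t = tapeAt (true ∷ []) (queueTail nothing (wordSymbols q₀ (trimmed t) ++ [ nothing ]))

  encodes : ∀ t → Transducer.Transduces encoder (configWord (Machine.initial A t))
                    (configWord (Machine.initial W (initialTape t)))
  encodes (tape l b r) = Enc.transduces⁺ encoding
    (subst (Encoding.Accepts w) (sym (configWord-start [] nothing w refl)) (encoding-complete w))
    where
    w : List InLetter
    w = tapeWord q₀ (tape l b r)

  represents-initial : ∀ t → Represents (length (wordSymbols q₀ (trimmed t)))
                               (Machine.initial A t) (Machine.initial W (initialTape t))
  represents-initial t = represents [] nothing (trimmed t) (trimmed-≈ t) refl
    (cong (λ k → config k (initialTape t)) (sym startControl≡zero))

  -- Time and space bounds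

  length-blocks : ∀ xs → length (blocks xs) ≡ length xs * unit
  length-blocks []       = refl
  length-blocks (x ∷ xs) = trans (length-++ (block false x))
    (cong₂ _+_ (sym (cong suc (length-tail x))) (length-blocks xs))

  cells-initialTape : ∀ t → let ℓ = length (wordSymbols q₀ (trimmed t)) in
                      cells (initialTape t) ≡ (3 + ℓ) * unit
  cells-initialTape t = begin
    suc (length (queueTail nothing ys))                  ≡⟨ cong suc (length-++ (onehot nothing ++ [ true ])) ⟩
    suc (length (onehot nothing ++ [ true ]) + length (blocks ys ++ freeBlock))
                                                         ≡⟨ cong (λ i → suc (i + length (blocks ys ++ freeBlock))) (length-tail nothing) ⟨
    unit + length (blocks ys ++ freeBlock)               ≡⟨ cong (unit +_) (length-++ (blocks ys)) ⟩
    unit + (length (blocks ys) + length freeBlock)       ≡⟨ cong₂ (λ i j → unit + (i + j)) (length-blocks ys) (length-replicate unit) ⟩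
    unit + (length ys * unit + unit)                     ≡⟨ cong (λ i → unit + (i * unit + unit)) (length-end xs) ⟩
    unit + (suc (length xs) * unit + unit)               ≡⟨ total (length xs) unit ⟩
    (3 + length xs) * unit                               ∎
    where
    open ≡-Reasoning
    xs ys : List Symbol
    xs = wordSymbols q₀ (trimmed t)
    ys = xs ++ [ nothing ]
    total : ∀ i u → u + (suc i * u + u) ≡ (3 + i) * u
    total = solve-∀

  length≤cells : ∀ q t → length (wordSymbols q (trimmed t)) ≤ cells t
  length≤cells q (tape l b r) = ≤-trans (≤-reflexive count) (+-mono-≤ (length-trim l) (s≤s (length-trim r)))
    where
    open ≡-Reasoning
    ls : List InLetter
    ls = map cell (reverse (trim l))
    count : length (wordSymbols q (tape (trim l) b (trim r))) ≡ length (trim l) + suc (length (trim r))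
    count = begin
      length (wordSymbols q (tape (trim l) b (trim r)))   ≡⟨ length-map just (ls ++ head q b ∷ map cell (trim r)) ⟩
      length (ls ++ head q b ∷ map cell (trim r))         ≡⟨ length-++ ls ⟩
      length ls + suc (length (map cell (trim r)))        ≡⟨ cong₂ (λ i j → i + suc j)
        (trans (length-map cell (reverse (trim l))) (length-reverse (trim l))) (length-map cell (trim r)) ⟩
      length (trim l) + suc (length (trim r))             ∎

  -- Turns the bound on the final cells into a bound on the input cells.
  cells-mono : ∀ k {c c′} → run next k c ≡ just c′ → cells (content c) ≤ cells (content c′)
  cells-mono zero    refl = ≤-refl
  cells-mono (suc k) {c} r with next c in eq
  ... | just c₁ = ≤-trans (cells-next eq) (cells-mono k r)

  cells-positive : ∀ t → 1 ≤ cells t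
  cells-positive (tape l b r) = ≤-trans (s≤s z≤n) (m≤n+m (suc (length r)) (length l))

  -- At most `2 * t` passes, `4 * t` symbols in each, `25 * t * unit` operations per symbol and 5
  -- instructions per operation; the product of the constants is 1000.
  time-bound : ∀ {k ℓ t} → k ≤ t → ℓ ≤ t → 1 ≤ t →
               suc k * phaseCost (2 * k + ℓ) ≤ 1000 * unit * t ^ 3
  time-bound {k} {ℓ} {t} k≤t ℓ≤t 1≤t = begin
    suc k * (suc i * popCost (suc i) * 5)                     ≡⟨ cong (λ p → suc k * (suc i * p * 5)) (popCost-≡ (suc i)) ⟩
    suc k * (suc i * ((17 + 2 * suc i) * unit) * 5)           ≤⟨ *-mono-≤ k≤ (*-monoˡ-≤ 5 (*-mono-≤ i≤ (*-monoˡ-≤ unit p≤))) ⟩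
    2 * t * (4 * t * (25 * t * unit) * 5)                     ≡⟨ total t unit ⟩
    1000 * unit * t ^ 3                                       ∎
    where
    open ≤-Reasoning
    i : ℕ
    i = 2 * k + ℓ
    k≤ : suc k ≤ 2 * t
    k≤ = ≤-trans (+-mono-≤ 1≤t k≤t) (≤-reflexive (cong (t +_) (sym (+-identityʳ t))))
    i≤ : suc i ≤ 4 * t
    i≤ = ≤-trans (+-mono-≤ 1≤t (+-mono-≤ (*-monoʳ-≤ 2 k≤t) ℓ≤t)) (≤-reflexive (four t))
      where
      four : ∀ t → t + (2 * t + t) ≡ 4 * t
      four = solve-∀
    p≤ : 17 + 2 * suc i ≤ 25 * t
    p≤ = ≤-trans (+-mono-≤ (*-monoʳ-≤ 17 1≤t) (*-monoʳ-≤ 2 i≤)) (≤-reflexive (twentyfive t))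
      where
      twentyfive : ∀ t → 17 * t + 2 * (4 * t) ≡ 25 * t
      twentyfive = solve-∀
    total : ∀ t u → 2 * t * (4 * t * (25 * t * u) * 5) ≡ 1000 * u * (t * (t * (t * 1)))
    total = solve-∀

  space-bound : ∀ {ℓ t} → ℓ ≤ t → 1 ≤ t → (3 + ℓ) * unit ≤ 4 * unit * t ^ 3
  space-bound {ℓ} {t} ℓ≤t 1≤t = begin
    (3 + ℓ) * unit                    ≤⟨ *-monoˡ-≤ unit (+-mono-≤ (*-monoʳ-≤ 3 1≤t) ℓ≤t) ⟩
    (3 * t + t) * unit                ≡⟨ total t unit ⟩
    4 * unit * (t * (1 * (1 * 1)))    ≤⟨ *-monoʳ-≤ (4 * unit) (*-monoʳ-≤ t (*-mono-≤ 1≤t (*-monoˡ-≤ 1 1≤t))) ⟩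
    4 * unit * t ^ 3                  ∎
    where
    open ≤-Reasoning
    total : ∀ t u → (3 * t + t) * u ≡ 4 * u * (t * (1 * (1 * 1)))
    total = solve-∀

  -- The cells used are at most the steps plus the initial cells, which raises 1000 to 1004.
  timed : ∀ t₀ t → RunsInTime A t₀ t → RunsInTime W (initialTape t₀) (1004 * unit * t ^ 3)
  timed t₀ t (k , d , e , k≤t , cells≤t) = k′ , proj₁ (proj₂ ended) , e′ ,
    ≤-trans k′≤ (*-monoˡ-≤ (t ^ 3) (*-monoˡ-≤ unit (m≤m+n 1000 4))) ,
    (begin
      cells (content (proj₁ (proj₂ ended)))            ≤⟨ cells-run k′ (proj₁ e′) ⟩
      k′ + cells (initialTape t₀)                      ≤⟨ +-mono-≤ k′≤ (≤-trans (≤-reflexive (cells-initialTape t₀)) (space-bound ℓ≤t 1≤t)) ⟩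
      1000 * unit * t ^ 3 + 4 * unit * t ^ 3           ≡⟨ total unit (t ^ 3) ⟩
      1004 * unit * t ^ 3                              ∎)
    where
    open ≤-Reasoning
    ended = Lift.ends-within (represents-initial t₀) k e
    k′ : ℕ
    k′ = proj₁ ended
    e′ : EndsAt stepW (Machine.initial W (initialTape t₀)) k′ (proj₁ (proj₂ ended))
    e′ = proj₁ (proj₂ (proj₂ ended))
    cells₀≤t : cells t₀ ≤ t
    cells₀≤t = ≤-trans (cells-mono k (proj₁ e)) cells≤t
    1≤t : 1 ≤ t
    1≤t = ≤-trans (cells-positive t₀) cells₀≤t
    ℓ≤t : length (wordSymbols q₀ (trimmed t₀)) ≤ t
    ℓ≤t = ≤-trans (length≤cells q₀ t₀) cells₀≤t
    k′≤ : k′ ≤ 1000 * unit * t ^ 3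
    k′≤ = ≤-trans (proj₂ (proj₂ (proj₂ ended))) (time-bound k≤t ℓ≤t 1≤t)
    total : ∀ u v → 1000 * u * v + 4 * u * v ≡ 1004 * u * v
    total = solve-∀

  emulates : Emulates W A (λ t → t ^ 3)
  emulates = record
    { encoder            = encoder
    ; decoder            = Decoder.compose
    ; constant           = 1004 * unit
    ; encoder-functional = encoder-functional
    ; decoder-functional = Decoder.compose-functional blockDecoder-functional trimmer-functional
    ; emulation          = λ t₀ → let inv = represents-initial t₀ in
        initialTape t₀ , encodes t₀ ,
        (Lift.time inv , Lift.time-increasing inv ,
         λ i c r → let d , r′ , _ , inv′ = Lift.reaches inv i r in d , r′ , decodes inv′) ,
        Lift.ends⇔ inv , timed t₀
    }

  emulated : Σ[ V ∈ WangB ] (WangB.Restricted V × Emulates (WangB.machine V) A (λ t → t ^ 3))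
  emulated = wangB , restricted , emulates

-- Turing machines as an instance

module _ (M : TuringMachine) where
  open TuringMachine M
  open Trimming (suc m) using (alphabet; ∈-alphabet)
  open Rewriting M
  open Phases δ start-memory using (Phase; HaltingPhase)

  symbols : List (Maybe (Letter State))
  symbols = nothing ∷ map just alphabet

  symbol-∈ : ∀ x → x ∈ˡ symbols
  symbol-∈ nothing  = here refl
  symbol-∈ (just y) = there (∈-map⁺ just (∈-alphabet y))

  -- A rule depends on the scanned symbol only, which equivalent tapes share; the padding of earlier
  -- passes is carried along by transitivity.
  phases : ∀ {q t q′ t′} u → u ≈ t → stepTM (config q t) ≡ just (config q′ t′) → Phase q u q′ t′
  phases {q} {t} u u≈t eq with f q (scanned t) in eqf
  phases {q} {t} u u≈t refl | just (b , d , q′) = record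
    { padded  = φ.padded
    ; padded≈ = ≈-trans φ.padded≈ (move-write-≈ d b u≈t)
    ; feeds   = φ.feeds
    ; closes  = φ.closes
    ; three   = φ.three
    ; result  = φ.result
    }
    where module φ = Phase (phase q u (trans (cong (f q) (_≈_.scanned≈ u≈t)) eqf))

  halting-phases : ∀ {q t} u → u ≈ t → stepTM (config q t) ≡ nothing → HaltingPhase q u
  halting-phases {q} {t} u u≈t eq with f q (scanned t) in eqf
  ... | nothing = halting-phase q u (trans (cong (f q) (_≈_.scanned≈ u≈t)) eqf)

  cells-step : ∀ {c c′} → stepTM c ≡ just c′ → cells (content c) ≤ cells (content c′)
  cells-step {config q t} eq with f q (scanned t)
  cells-step {config q t@(tape _ _ _)} refl | just (b , d , q′) = cells≤cells-move d (write b t)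

  emulation : Σ[ W ∈ WangB ] (WangB.Restricted W × Emulates (WangB.machine W) machine (λ t → t ^ 3))
  emulation = PhaseSimulation.emulated zero stepTM δ start-memory memories memory-∈ refl
                symbols symbol-∈ phases halting-phases cells-step

theorem9 : (U : HooperMachine) → SimulatesRestrictedWangB U →
    (M : TuringMachine) → Simulates U (TuringMachine.machine M) (λ t → t ^ 3)
theorem9 U simulates M =
  let W , restricted , emulates = emulation M
  in simulates-trans (simulates W restricted) emulates
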